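{- The scheduling problem $P\,|\,\mathrm{prec}, p_j=1\,|\,C_{\max}$ can be solved in time $O^{\star}(2^{n-m}+\#\mathrm{AC})$, where $n$ is the number of jobs, $m$ is the number of machines, and $\#\mathrm{AC}$ is the number of antichains of the precedence order.
   Context: Problem $P\,|\,\mathrm{prec}, p_j=1\,|\,C_{\max}$: the input is a set $V$ of $n$ unit-length jobs, a strict partial order $\prec$ on $V$ (the precedence constraints), and a number $m$ of identical machines. A schedule of makespan $T$ is a partition of $V$ into time slots $S_1,\dots,S_T$ with $|S_t|\le m$ for every $t$, such that whenever $v\prec w$, $v\in S_t$ and $w\in S_{t'}$, we have $t<t'$. The goal is to find the minimum makespan $T$ of a schedule. An antichain is a set of pairwise incomparable jobs. $O^{\star}(\cdot)$ hides factors polynomial in the input size. -}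

module Defs where

open import Level using (0ℓ)
open import Data.Bool using (Bool; true; false)
open import Data.Fin using (Fin)
import Data.Fin as Fin
open import Data.Fin.Properties using (all?)
open import Data.Fin.Subset using (Subset; inside; outside; _∈_; ∣_∣)
open import Data.Fin.Subset.Properties using (_∈?_)
open import Data.List using (List; []; _∷_; [_]; _++_; map; filter; foldr; length; allFin)
open import Data.Nat using (ℕ; zero; suc; _+_; _≤_; NonZero)
open import Data.Nat.Binary using (ℕᵇ; zero; 2[1+_]; 1+[2_]; fromℕ)
open import Data.Product using (_×_; ∃!)
open import Data.Vec using (Vec; []; _∷_; lookup)
open import Relation.Binary using (Rel; IsDecStrictPartialOrder)
open import Relation.Binary.PropositionalEquality using (_≡_; _≢_)
open import Relation.Nullary using (¬_; Dec; does)
open import Relation.Nullary.Decidable using (¬?; _→-dec_; _×-dec_)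

record Instance : Set₁ where
  infix 4 _≺_
  field
    n         : ℕ
    m         : ℕ
    {{m≢0}}   : NonZero m
    _≺_       : Rel (Fin n) 0ℓ
    isDecSPO  : IsDecStrictPartialOrder _≡_ _≺_

  open IsDecStrictPartialOrder isDecSPO public
    using (_≟_) renaming (_<?_ to _≺?_)

record Schedule (I : Instance) (T : ℕ) : Set where
  open Instance I
  field
    slot       : Fin T → Subset n
    partition  : ∀ v → ∃! _≡_ (λ t → v ∈ slot t)
    capacity   : ∀ t → ∣ slot t ∣ ≤ m
    precedence : ∀ {v w t t′} → v ≺ w → v ∈ slot t → w ∈ slot t′ → t Fin.< t′

IsMinMakespan : Instance → ℕ → Set
IsMinMakespan I T = Schedule I T × (∀ T′ → Schedule I T′ → T ≤ T′)

allSubsets : ∀ n → List (Subset n)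
allSubsets zero    = [ [] ]
allSubsets (suc n) = map (outside ∷_) (allSubsets n) ++ map (inside ∷_) (allSubsets n)

module _ (I : Instance) where
  open Instance I

  IsAntichain : Subset n → Set
  IsAntichain A = ∀ v → v ∈ A → ∀ w → w ∈ A → v ≢ w → ¬ (v ≺ w) × ¬ (w ≺ v)

  isAntichain? : ∀ A → Dec (IsAntichain A)
  isAntichain? A =
    all? λ v → (v ∈? A) →-dec all? λ w → (w ∈? A) →-dec
      (¬? (v ≟ w) →-dec (¬? (v ≺? w) ×-dec ¬? (w ≺? v)))

  #AC : ℕ
  #AC = length (filter isAntichain? (allSubsets n))

-- Programs: first-order, call-by-value, mutually recursive functions on binary
-- trees (pure first-order Lisp with a single atom), with unit cost per
-- evaluation step.  A tree is a pointer to a cons cell and evaluation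
-- never copies a tree, so each step takes O(1) operations on a RAM whose
-- words hold a pointer.  Conversely such programs simulate a RAM that
-- runs for t steps on O(log t)-bit words with overhead polynomial in
-- log t.  Hence bounds up to factors polynomial in the input size
-- coincide in both models, for running times at most exponential in a
-- polynomial of the input size.

infixr 5 _∙_

data Tree : Set where
  nil : Tree
  _∙_ : Tree → Tree → Tree

size : Tree → ℕ
size nil     = 1
size (x ∙ y) = 1 + size x + size y

-- Functions are named by Fin k, function f taking arity f arguments;
-- Expr arity s is the type of expressions with s variables in scope.
-- In case, the head and the tail of the scrutinee become variables 0 and 1
-- of the second branch.

data Expr {k : ℕ} (arity : Fin k → ℕ) (s : ℕ) : Set where
  var  : Fin s → Expr arity s
  nil  : Expr arity s
  cons : Expr arity s → Expr arity s → Expr arity s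
  case : Expr arity s → Expr arity s → Expr arity (2 + s) → Expr arity s
  bind : Expr arity s → Expr arity (1 + s) → Expr arity s
  call : (f : Fin k) → Vec (Expr arity s) (arity f) → Expr arity s

record Program : Set where
  field
    {functions} : ℕ
    arity       : Fin functions → ℕ
    body        : (f : Fin functions) → Expr arity (arity f)
    main        : Expr arity 1

module Evaluation (P : Program) where
  open Program P

  infix 4 _⊢_⇓_⟨_⟩ _⊢_⇓*_⟨_⟩

  mutual
    data _⊢_⇓_⟨_⟩ {s} (ρ : Vec Tree s) : Expr arity s → Tree → ℕ → Set where
      var  : ∀ i → ρ ⊢ var i ⇓ lookup ρ i ⟨ 1 ⟩
      nil  : ρ ⊢ nil ⇓ nil ⟨ 1 ⟩
      cons : ∀ {e₁ e₂ x₁ x₂ c₁ c₂} →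
             ρ ⊢ e₁ ⇓ x₁ ⟨ c₁ ⟩ → ρ ⊢ e₂ ⇓ x₂ ⟨ c₂ ⟩ →
             ρ ⊢ cons e₁ e₂ ⇓ x₁ ∙ x₂ ⟨ 1 + c₁ + c₂ ⟩
      case-nil  : ∀ {e e₁ e₂ x c c₁} →
                  ρ ⊢ e ⇓ nil ⟨ c ⟩ → ρ ⊢ e₁ ⇓ x ⟨ c₁ ⟩ →
                  ρ ⊢ case e e₁ e₂ ⇓ x ⟨ 1 + c + c₁ ⟩
      case-cons : ∀ {e e₁ e₂ h t x c c₂} →
                  ρ ⊢ e ⇓ h ∙ t ⟨ c ⟩ → (h ∷ t ∷ ρ) ⊢ e₂ ⇓ x ⟨ c₂ ⟩ →
                  ρ ⊢ case e e₁ e₂ ⇓ x ⟨ 1 + c + c₂ ⟩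
      bind : ∀ {e e₁ x y c c₁} →
             ρ ⊢ e ⇓ x ⟨ c ⟩ → (x ∷ ρ) ⊢ e₁ ⇓ y ⟨ c₁ ⟩ →
             ρ ⊢ bind e e₁ ⇓ y ⟨ 1 + c + c₁ ⟩
      call : ∀ {f es xs y c c₁} →
             ρ ⊢ es ⇓* xs ⟨ c ⟩ → xs ⊢ body f ⇓ y ⟨ c₁ ⟩ →
             ρ ⊢ call f es ⇓ y ⟨ 1 + c + c₁ ⟩

    data _⊢_⇓*_⟨_⟩ {s} (ρ : Vec Tree s) :
         ∀ {l} → Vec (Expr arity s) l → Vec Tree l → ℕ → Set where
      []  : ρ ⊢ [] ⇓* [] ⟨ 0 ⟩
      _∷_ : ∀ {l e x c c′} {es : Vec (Expr arity s) l} {xs} →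
            ρ ⊢ e ⇓ x ⟨ c ⟩ → ρ ⊢ es ⇓* xs ⟨ c′ ⟩ →
            ρ ⊢ (e ∷ es) ⇓* (x ∷ xs) ⟨ c + c′ ⟩

_on_outputs_after_steps : Program → Tree → Tree → ℕ → Set
P on x outputs y after c steps = (x ∷ []) ⊢ Program.main P ⇓ y ⟨ c ⟩
  where open Evaluation P

encodeBool : Bool → Tree
encodeBool false = nil
encodeBool true  = nil ∙ nil

encodeList : List Tree → Tree
encodeList = foldr _∙_ nil

-- Binary, least significant digit first, in the library's bijective
-- numeration; the encoding of k has size O(log k).
encodeℕᵇ : ℕᵇ → Tree
encodeℕᵇ zero     = nil
encodeℕᵇ 2[1+ k ] = encodeBool false ∙ encodeℕᵇ k
encodeℕᵇ 1+[2 k ] = encodeBool true ∙ encodeℕᵇ k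

encodeℕ : ℕ → Tree
encodeℕ k = encodeℕᵇ (fromℕ k)

encodeInstance : Instance → Tree
encodeInstance I =
  encodeℕ m ∙ encodeList (map row (allFin n))
  where
  open Instance I
  row : Fin n → Tree
  row v = encodeList (map (λ w → encodeBool (does (v ≺? w))) (allFin n))

{-# OPTIONS --safe #-}
-- Schedule backwards: the jobs of the last t slots form an upset of the order,
-- and there are exactly #AC upsets, one for each antichain of minimal elements.
-- With the jobs listed so that successors come first, a family of upsets is a
-- binary trie all of whose paths can be completed to an upset, so that it has
-- O(n · #AC) nodes.  The family for t + 1 slots arises from that for t slots in
-- one recursive pass: below a node that branches on job j, if all successors of
-- j are in the old set, then every new set without j is copied, with its budget
-- of free machines decreased, to the side of the sets with j.  Jobs further down
-- have been added before that, and the successors of j are compared with the old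
-- set only, so that no two related jobs enter the same slot.  Merging two tries
-- is a union of trees, which also takes the maximum of the unary budgets at the
-- leaves.  At most n passes are made before the set of all jobs is reached.
module Submission where

open import Data.Bool using (Bool; true; false; if_then_else_; _∨_)
open import Data.Bool.Properties using (∨-identityʳ; ∨-zeroʳ) renaming (_≟_ to _≟ᵇ_)
open import Data.Fin as Fin using (Fin; zero; suc; toℕ; #_; fromℕ<; opposite)
open import Data.Fin.Induction using (spo-wellFounded)
import Data.Fin.Properties as Fin
open import Data.Fin.Subset using (Subset; ∣_∣; inside; outside)
import Data.Fin.Subset as Subset
import Data.Fin.Subset.Properties as Subset
open import Data.List as List using (List; []; _∷_; _++_; length; map; tabulate; allFin; foldr; filter)
open import Data.List.Membership.Propositional using (_∈_; _∉_)
open import Data.List.Membership.Propositional.Properties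
  using (∈-lookup; ∈-map⁺; ∈-map⁻; ∈-++⁺ˡ; ∈-++⁺ʳ; ∈-++⁻; ∈-filter⁺; ∈-filter⁻; ∈-allFin)
open import Data.List.Properties
  using (map-tabulate; length-map; length-tabulate; length-++; filter-accept; filter-reject; length-filter)
open import Data.List.Relation.Binary.Permutation.Propositional
  using (_↭_; prep; swap; ↭-refl; ↭-sym; ↭-trans; ↭⇒↭ₛ)
open import Data.List.Relation.Binary.Permutation.Propositional.Properties using (↭-length; ∈-resp-↭; All-resp-↭)
import Data.List.Relation.Binary.Permutation.Setoid.Properties as Permutation
open import Data.List.Relation.Unary.All as All using (All; []; _∷_)
open import Data.List.Relation.Unary.AllPairs using (AllPairs; []; _∷_)
import Data.List.Relation.Unary.AllPairs.Properties as AllPairs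
open import Data.List.Relation.Unary.Any using (here; there; index)
open import Data.List.Relation.Unary.Any.Properties using (lookup-index)
open import Data.List.Relation.Unary.Unique.Propositional using (Unique)
import Data.List.Relation.Unary.Unique.Propositional.Properties as Unique
open import Data.Nat as ℕ hiding (_≟_)
open import Data.Nat.Binary as ℕᵇ using (zero; 2[1+_]; 1+[2_]; fromℕ')
open import Data.Nat.Binary.Properties using (fromℕ≡fromℕ'; fromℕ-injective)
open import Data.Nat.Properties hiding (_≟_)
open import Data.Nat.Tactic.RingSolver using (solve-∀)
open import Data.Product using (∃-syntax; _×_; _,_; proj₁; proj₂)
open import Data.Sum using (_⊎_; inj₁; inj₂; [_,_])
open import Data.Vec as Vec using (Vec; []; _∷_; lookup)
open import Data.Vec.Properties using (lookup∘tabulate; []=⇒lookup; lookup⇒[]=)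
open import Function using (_∘_; id)
open import Induction.WellFounded using (Acc; acc)
open import Relation.Binary using (IsDecStrictPartialOrder; tri<; tri≈; tri>)
open import Relation.Binary.PropositionalEquality hiding ([_])
open import Relation.Nullary using (¬_; Dec; does; yes; no; contradiction)
open import Relation.Nullary.Decidable using (True; from-yes; dec-true; dec-false; ¬?; _→-dec_; _×-dec_)
open import Relation.Unary using (Decidable)
open import Defs

-- Putting every possible slot on top of every old upset would enumerate pairs: with enough
-- machines, n unrelated jobs give 3^n of them against 2^n antichains. Hence the jobs of a slot
-- enter one at a time, and of all its origins a new set remembers only the largest number of
-- machines left. Capacity depends on the number of added jobs alone, so this maximum decides
-- whether some origin is admissible. The sets met during a pass are again upsets, so the
-- intermediate tries obey the same size bound as the final ones. Merging at a node costs the size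
-- of the subtries there. With N the size of the input, a leaf accounts for O(N) tree nodes and is
-- merged at O(N) levels, so a pass takes O(N² · #AC) calls; O(N) passes give the factor N³.

-- Cost of a run, measured in calls

weight  : ∀ {k} {arity : Fin k → ℕ} {s} → Expr arity s → ℕ
weight* : ∀ {k} {arity : Fin k → ℕ} {s l} → Vec (Expr arity s) l → ℕ
weight (var _)        = 1
weight nil            = 1
weight (cons e₁ e₂)   = 1 + weight e₁ + weight e₂
weight (case e e₁ e₂) = 1 + weight e + (weight e₁ + weight e₂)
weight (bind e e₁)    = 1 + weight e + weight e₁
weight (call _ es)    = 1 + weight* es
weight* []       = 0
weight* (e ∷ es) = weight e + weight* es

-- Apart from the calls, an expression costs at most its weight.  So a run is
-- measured by its number k of calls alone, K being the price of one call.
module Counting (P : Program) (K : ℕ) (weight≤K : ∀ f → weight (Program.body P f) ≤ K) where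
  open Program P
  open Evaluation P

  record Run {s} (ρ : Vec Tree s) (e : Expr arity s) (x : Tree) (k : ℕ) : Set where
    constructor run
    field
      {cost} : ℕ
      eval   : ρ ⊢ e ⇓ x ⟨ cost ⟩
      bound  : cost ≤ weight e + K * k

  record Runs {s l} (ρ : Vec Tree s) (es : Vec (Expr arity s) l) (xs : Vec Tree l) (k : ℕ) : Set where
    constructor runs
    field
      {cost} : ℕ
      eval   : ρ ⊢ es ⇓* xs ⟨ cost ⟩
      bound  : cost ≤ weight* es + K * k

  -- The inequality is strict because the call of `f` itself is one of the `k`: in `call′` it pays
  -- the price `K`, which covers the weight of the body.
  record App (f : Fin functions) (xs : Vec Tree (arity f)) (y : Tree) (k : ℕ) : Set where
    constructor app
    field
      {calls} : ℕ
      runBody : Run xs (body f) y calls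
      calls<  : calls < k

  private
    bound-+ : ∀ {c c′ w w′} k k′ → c ≤ w + K * k → c′ ≤ w′ + K * k′ → c + c′ ≤ w + w′ + K * (k + k′)
    bound-+ {c} {c′} {w} {w′} k k′ p q = begin
      c + c′                         ≤⟨ +-mono-≤ p q ⟩
      w + K * k + (w′ + K * k′)      ≡⟨ lemma w w′ K k k′ ⟩
      w + w′ + K * (k + k′)          ∎
      where
      open ≤-Reasoning
      lemma : ∀ w w′ K k k′ → w + K * k + (w′ + K * k′) ≡ w + w′ + K * (k + k′)
      lemma = solve-∀

    bound-⊔ˡ : ∀ {c w b} w′ → c ≤ w + b → c ≤ w + w′ + b
    bound-⊔ˡ {w = w} {b} w′ p = ≤-trans p (+-monoˡ-≤ b (m≤m+n w w′))

    bound-⊔ʳ : ∀ {c w b} w′ → c ≤ w + b → c ≤ w′ + w + b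
    bound-⊔ʳ {w = w} {b} w′ p = ≤-trans p (+-monoˡ-≤ b (m≤n+m w w′))

  module _ {s} {ρ : Vec Tree s} where
    var′ : ∀ {i} → Run ρ (var i) (lookup ρ i) 0
    var′ = run (var _) (m≤m+n 1 _)

    nil′ : Run ρ nil nil 0
    nil′ = run nil (m≤m+n 1 _)

    cons′ : ∀ {e₁ e₂ x₁ x₂ k₁ k₂} → Run ρ e₁ x₁ k₁ → Run ρ e₂ x₂ k₂ → Run ρ (cons e₁ e₂) (x₁ ∙ x₂) (k₁ + k₂)
    cons′ {k₁ = k₁} {k₂} (run d₁ p₁) (run d₂ p₂) = run (cons d₁ d₂) (s≤s (bound-+ k₁ k₂ p₁ p₂))

    case-nil′ : ∀ {e e₁ e₂ x k k₁} → Run ρ e nil k → Run ρ e₁ x k₁ → Run ρ (case e e₁ e₂) x (k + k₁)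
    case-nil′ {e₁ = e₁} {e₂} {k = k} {k₁} (run d p) (run d₁ p₁) =
      run (case-nil d d₁) (s≤s (bound-+ k k₁ p (bound-⊔ˡ {w = weight e₁} {K * k₁} (weight e₂) p₁)))

    case-cons′ : ∀ {e e₁ e₂ h t x k k₂} → Run ρ e (h ∙ t) k → Run (h ∷ t ∷ ρ) e₂ x k₂ →
                 Run ρ (case e e₁ e₂) x (k + k₂)
    case-cons′ {e₁ = e₁} {e₂} {k = k} {k₂} (run d p) (run d₂ p₂) =
      run (case-cons d d₂) (s≤s (bound-+ k k₂ p (bound-⊔ʳ {w = weight e₂} {K * k₂} (weight e₁) p₂)))

    bind′ : ∀ {e e₁ x y k k₁} → Run ρ e x k → Run (x ∷ ρ) e₁ y k₁ → Run ρ (bind e e₁) y (k + k₁)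
    bind′ {k = k} {k₁} (run d p) (run d₁ p₁) = run (bind d d₁) (s≤s (bound-+ k k₁ p p₁))

    infixr 5 _∷′_

    []′ : Runs ρ [] [] 0
    []′ = runs [] z≤n

    _∷′_ : ∀ {l e x k k′} {es : Vec (Expr arity s) l} {xs} → Run ρ e x k → Runs ρ es xs k′ →
           Runs ρ (e ∷ es) (x ∷ xs) (k + k′)
    _∷′_ {k = k} {k′} (run d p) (runs ds ps) = runs (d ∷ ds) (bound-+ k k′ p ps)

    call′ : ∀ {f es xs y k k₁} → Runs ρ es xs k → App f xs y k₁ → Run ρ (call f es) y (k + k₁)
    call′ {f} {es} {k = k} {k₁} (runs {c} ds p) (app {j} (run {c₁} d p₁) j<k₁) = run (call ds d) (s≤s (begin
      c + c₁                               ≤⟨ +-mono-≤ p p₁ ⟩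
      weight* es + K * k + (weight (body f) + K * j)
                                           ≤⟨ +-monoʳ-≤ (weight* es + K * k) (+-monoˡ-≤ (K * j) (weight≤K f)) ⟩
      weight* es + K * k + (K + K * j)     ≡⟨ lemma (weight* es) K k j ⟩
      weight* es + K * (k + suc j)         ≤⟨ +-monoʳ-≤ (weight* es) (*-monoʳ-≤ K (+-monoʳ-≤ k j<k₁)) ⟩
      weight* es + K * (k + k₁)            ∎))
      where
      open ≤-Reasoning
      lemma : ∀ w K k j → w + K * k + (K + K * j) ≡ w + K * (k + suc j)
      lemma = solve-∀

-- The program

pattern SUB    = zero
pattern UNION  = suc SUB
pattern EQ     = suc UNION
pattern INC    = suc EQ
pattern CAP    = suc INC
pattern INSERT = suc CAP
pattern MK     = suc INSERT
pattern INIT   = suc MK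
pattern FULL   = suc INIT
pattern DEC    = suc FULL
pattern STEP   = suc DEC
pattern LOOP   = suc STEP

arity : Fin 12 → ℕ
arity SUB    = 2
arity UNION  = 2
arity EQ     = 2
arity INC    = 1
arity CAP    = 3
arity INSERT = 3
arity MK     = 2
arity INIT   = 1
arity FULL   = 2
arity DEC    = 2
arity STEP   = 4
arity LOOP   = 4

v : ∀ {s} i {i<s : True (suc i ≤? s)} → Expr arity s
v i {i<s} = var (#_ i {m<n = i<s})

yes′ : ∀ {s} → Expr arity s
yes′ = cons nil nil

-- The arguments stand above each body, and the variables bound by case and
-- bind in brackets, innermost first.
body : ∀ f → Expr arity (arity f)
-- a b
body SUB =
  case (v 0) yes′                                               -- [h t]
    (case (v 0)
      (case (v 3) (call SUB (v 1 ∷ nil ∷ []))                   -- [g u]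
        (call SUB (v 3 ∷ v 1 ∷ [])))                            -- [_ _]
      (case (v 5) nil                                           -- [g u]
        (case (v 0) nil                                         -- [_ _]
          (call SUB (v 7 ∷ v 3 ∷ [])))))
-- a b
body UNION =
  case (v 0) (v 1)                                              -- [h t]
    (case (v 3) (v 2)                                           -- [g u]
      (cons (call UNION (v 2 ∷ v 0 ∷ [])) (call UNION (v 3 ∷ v 1 ∷ []))))
-- a b
body EQ =
  case (v 0) (case (v 1) yes′ nil)                              -- [h t]
    (case (v 3) nil                                             -- [g u]
      (case (call EQ (v 2 ∷ v 0 ∷ [])) nil                      -- [_ _]
        (call EQ (v 5 ∷ v 3 ∷ []))))
-- k
body INC =
  case (v 0) (cons yes′ nil)                                    -- [h t]
    (case (v 0) (cons yes′ (call INC (v 1 ∷ [])))               -- [_ _]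
      (cons nil (v 3)))
-- jobs m c
body CAP =
  case (v 0) nil                                                -- [_ jobs]
    (case (call EQ (v 4 ∷ v 3 ∷ []))
      (cons nil (call CAP (v 1 ∷ v 3 ∷ call INC (v 4 ∷ []) ∷ [])))
      nil)
-- e r jobs
body INSERT =
  case (v 2) (cons (cons (v 0) (v 1)) nil)                      -- [job jobs]
    (case (v 0) nil                                             -- [e′ r′]
      (case (call SUB (v 4 ∷ v 1 ∷ []))
        (cons (v 2) (call INSERT (v 4 ∷ v 5 ∷ v 3 ∷ [])))       -- [_ _]
        (cons (cons (v 6) (v 7)) (v 8))))
-- rows e
body MK =
  case (v 0) nil                                                -- [r rows]
    (call INSERT (v 3 ∷ v 0 ∷ call MK (v 1 ∷ cons nil (v 3) ∷ []) ∷ []))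
-- jobs
body INIT =
  case (v 0) yes′                                               -- [_ jobs]
    (cons (call INIT (v 1 ∷ [])) nil)
-- jobs t
body FULL =
  case (v 0) (v 1)                                              -- [_ jobs]
    (case (v 3) nil                                             -- [a b]
      (call FULL (v 3 ∷ v 1 ∷ [])))
-- jobs t
body DEC =
  case (v 0) (case (v 1) nil (v 1))                             -- [_ jobs]
    (case (v 3) nil                                             -- [a b]
      (cons (call DEC (v 3 ∷ v 0 ∷ [])) (call DEC (v 3 ∷ v 1 ∷ []))))
-- jobs d t w
body STEP =
  case (v 0) (case (v 2) nil (v 5))                             -- [job jobs]
    (case (v 4) nil                                             -- [a b]
      (bind (call STEP (v 3 ∷ v 5 ∷ v 0 ∷ v 7 ∷ []))            -- [o]
        (case (v 3) nil                                         -- [e r]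
          (case (call SUB (v 1 ∷ v 8 ∷ [])) (cons (v 2) nil)    -- [_ _]
            (cons (v 4)
              (call UNION (call STEP (v 8 ∷ call UNION (v 2 ∷ v 10 ∷ []) ∷ v 6 ∷ v 12 ∷ []) ∷
                           call DEC (v 8 ∷ v 4 ∷ []) ∷ [])))))))
-- jobs t T w
body LOOP =
  case (call FULL (v 0 ∷ v 1 ∷ []))
    (call LOOP (v 0 ∷ call STEP (v 0 ∷ nil ∷ v 1 ∷ v 3 ∷ []) ∷ call INC (v 2 ∷ []) ∷ v 3 ∷ []))  -- [_ _]
    (v 4)

-- m ∙ rows
solver : Program
solver = record
  { arity = arity
  ; body  = body
  ; main  =
      case (v 0) nil                                            -- [m rows]
        (bind (call MK (v 1 ∷ cons yes′ nil ∷ []))              -- [jobs]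
          (call LOOP (v 0 ∷ call INIT (v 0 ∷ []) ∷ nil ∷
                      cons nil (call CAP (v 0 ∷ v 1 ∷ nil ∷ [])) ∷ [])))
  }

open Counting solver 50 (from-yes (Fin.all? λ f → weight (body f) ≤? 50))

-- The functions computed and their numbers of calls

unary : ℕ → Tree
unary zero    = nil
unary (suc k) = nil ∙ unary k

-- Inclusion of sets of jobs, which are lists of bits, read as if continued by zeros.
sub : Tree → Tree → Bool
sub nil                 _             = true
sub (nil ∙ t)           nil           = sub t nil
sub (nil ∙ t)           (_ ∙ u)       = sub t u
sub ((_ ∙ _) ∙ t)       nil           = false
sub ((_ ∙ _) ∙ t)       (nil ∙ u)     = false
sub ((_ ∙ _) ∙ t)       ((_ ∙ _) ∙ u) = sub t u

-- It also acts on bit lists, since `nil` and `nil ∙ nil` are the two bits; this is how a pass adds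
-- a job to the set it carries along.
union : Tree → Tree → Tree
union nil     b       = b
union (h ∙ t) nil     = h ∙ t
union (h ∙ t) (g ∙ u) = union h g ∙ union t u

eq : Tree → Tree → Bool
eq nil     nil     = true
eq nil     (_ ∙ _) = false
eq (_ ∙ _) nil     = false
eq (h ∙ t) (g ∙ u) = if eq h g then eq t u else false

-- A trie of depth d stores in a ∙ b the sets without and with the first job; nil
-- is the empty family at every depth.  A leaf is nil if its set is absent and
-- otherwise unary (suc k), where k more jobs may enter the current slot.
init : ℕ → Tree
init zero    = nil ∙ nil
init (suc d) = init d ∙ nil

full : ℕ → Tree → Tree
full zero    t       = t
full (suc d) nil     = nil
full (suc d) (a ∙ b) = full d b

dec : ℕ → Tree → Tree
dec zero    nil     = nil
dec zero    (h ∙ t) = t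
dec (suc d) nil     = nil
dec (suc d) (a ∙ b) = dec d a ∙ dec d b

size-pos : ∀ t → 1 ≤ size t
size-pos nil     = ≤-refl
size-pos (_ ∙ _) = s≤s z≤n

-- Here and in `union-app` the bound mentions only the first argument. A row or a `unit` stands
-- there when the second is the set `D` carried through a pass, so the size of `D` never enters the
-- estimates.
sub-app : ∀ a b → App SUB (a ∷ b ∷ []) (encodeBool (sub a b)) (size a)
sub-app nil       b       = app (case-nil′ var′ (cons′ nil′ nil′)) ≤-refl
sub-app (nil ∙ t) nil     =
  app (case-cons′ var′ (case-nil′ var′ (case-nil′ var′ (call′ (var′ ∷′ nil′ ∷′ []′) (sub-app t nil)))))
      (m≤n+m _ 1)
sub-app (nil ∙ t) (_ ∙ u) =
  app (case-cons′ var′ (case-nil′ var′ (case-cons′ var′ (call′ (var′ ∷′ var′ ∷′ []′) (sub-app t u)))))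
      (m≤n+m _ 1)
sub-app ((_ ∙ _) ∙ t) nil           = app (case-cons′ var′ (case-cons′ var′ (case-nil′ var′ nil′))) (s≤s z≤n)
sub-app ((_ ∙ _) ∙ t) (nil ∙ u)     =
  app (case-cons′ var′ (case-cons′ var′ (case-cons′ var′ (case-nil′ var′ nil′)))) (s≤s z≤n)
sub-app (p@(_ ∙ _) ∙ t) ((_ ∙ _) ∙ u) =
  app (case-cons′ var′ (case-cons′ var′ (case-cons′ var′ (case-cons′ var′ (call′ (var′ ∷′ var′ ∷′ []′) (sub-app t u))))))
      (s≤s (m≤n+m (size t) (size p)))

union-app : ∀ a b → App UNION (a ∷ b ∷ []) (union a b) (size a)
union-app nil     b       = app (case-nil′ var′ var′) ≤-refl
union-app (h ∙ t) nil     = app (case-cons′ var′ (case-nil′ var′ var′)) (s≤s z≤n)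
union-app (h ∙ t) (g ∙ u) =
  app (case-cons′ var′ (case-cons′ var′
        (cons′ (call′ (var′ ∷′ var′ ∷′ []′) (union-app h g)) (call′ (var′ ∷′ var′ ∷′ []′) (union-app t u)))))
      ≤-refl

-- Charged to the second argument: `CAP` compares a growing counter with the fixed number of
-- machines.
eq-app : ∀ a b → App EQ (a ∷ b ∷ []) (encodeBool (eq a b)) (size b)
eq-app nil     nil     = app (case-nil′ var′ (case-nil′ var′ (cons′ nil′ nil′))) ≤-refl
eq-app nil     (g ∙ u) = app (case-nil′ var′ (case-cons′ var′ nil′)) (s≤s z≤n)
eq-app (h ∙ t) nil     = app (case-cons′ var′ (case-nil′ var′ nil′)) ≤-refl
eq-app (h ∙ t) (g ∙ u) with eq h g | eq-app h g
... | false | hg =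
  app (case-cons′ var′ (case-cons′ var′ (case-nil′ (call′ (var′ ∷′ var′ ∷′ []′) hg) nil′)))
      (s≤s (+-monoʳ-≤ (size g) z≤n))
... | true  | hg =
  app (case-cons′ var′ (case-cons′ var′ (case-cons′ (call′ (var′ ∷′ var′ ∷′ []′) hg)
        (call′ (var′ ∷′ var′ ∷′ []′) (eq-app t u)))))
      ≤-refl

eq-refl : ∀ a → eq a a ≡ true
eq-refl nil     = refl
eq-refl (h ∙ t) rewrite eq-refl h = eq-refl t

eq-sound : ∀ a b → eq a b ≡ true → a ≡ b
eq-sound nil     nil     _ = refl
eq-sound (h ∙ t) (g ∙ u) p with eq h g in e
... | true = cong₂ _∙_ (eq-sound h g e) (eq-sound t u p)

∙-injectiveʳ : ∀ {h t g u} → h ∙ t ≡ g ∙ u → t ≡ u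
∙-injectiveʳ refl = refl

encodeℕᵇ-injective : ∀ a b → encodeℕᵇ a ≡ encodeℕᵇ b → a ≡ b
encodeℕᵇ-injective zero     zero     _ = refl
encodeℕᵇ-injective zero     2[1+ _ ] ()
encodeℕᵇ-injective zero     1+[2 _ ] ()
encodeℕᵇ-injective 2[1+ _ ] zero     ()
encodeℕᵇ-injective 1+[2 _ ] zero     ()
encodeℕᵇ-injective 2[1+ _ ] 1+[2 _ ] ()
encodeℕᵇ-injective 1+[2 _ ] 2[1+ _ ] ()
encodeℕᵇ-injective 2[1+ a ] 2[1+ b ] p = cong 2[1+_] (encodeℕᵇ-injective a b (∙-injectiveʳ p))
encodeℕᵇ-injective 1+[2 a ] 1+[2 b ] p = cong 1+[2_] (encodeℕᵇ-injective a b (∙-injectiveʳ p))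

encodeℕ-injective : ∀ {a b} → encodeℕ a ≡ encodeℕ b → a ≡ b
encodeℕ-injective p = fromℕ-injective (encodeℕᵇ-injective _ _ p)

incᵇ-app : ∀ k → App INC (encodeℕᵇ k ∷ []) (encodeℕᵇ (ℕᵇ.suc k)) (suc (ℕᵇ.size k))
incᵇ-app zero     = app (case-nil′ var′ (cons′ (cons′ nil′ nil′) nil′)) ≤-refl
incᵇ-app 2[1+ k ] =
  app (case-cons′ var′ (case-nil′ var′ (cons′ (cons′ nil′ nil′) (call′ (var′ ∷′ []′) (incᵇ-app k))))) ≤-refl
incᵇ-app 1+[2 k ] = app (case-cons′ var′ (case-cons′ var′ (cons′ nil′ var′))) (s≤s z≤n)

digits-suc : ∀ k → ℕᵇ.size (ℕᵇ.suc k) ≤ suc (ℕᵇ.size k)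
digits-suc zero     = ≤-refl
digits-suc 2[1+ k ] = s≤s (digits-suc k)
digits-suc 1+[2 k ] = n≤1+n _

digits-fromℕ' : ∀ k → ℕᵇ.size (fromℕ' k) ≤ k
digits-fromℕ' zero    = z≤n
digits-fromℕ' (suc k) = ≤-trans (digits-suc (fromℕ' k)) (s≤s (digits-fromℕ' k))

inc-app : ∀ k → App INC (encodeℕ k ∷ []) (encodeℕ (suc k)) (suc k)
-- `fromℕ'` iterates the binary successor, so both encodings become consecutive values of that
-- iteration.
inc-app k rewrite fromℕ≡fromℕ' k | fromℕ≡fromℕ' (suc k) with incᵇ-app (fromℕ' k)
... | app r p = app r (≤-trans p (s≤s (digits-fromℕ' k)))

-- `c` is the counter and `c + r` the number of machines. Since `c + length js` is invariant under
-- the recursion, one `b` bounds the comparison and the increment of every round.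
cap-app : ∀ js c r {b} → size (encodeℕ (c + r)) + (c + length js) ≤ b →
          App CAP (encodeList js ∷ encodeℕ (c + r) ∷ encodeℕ c ∷ []) (unary (length js ⊓ r)) (suc (length js * suc b))
cap-app []       c r       _ = app (case-nil′ var′ nil′) ≤-refl
cap-app (_ ∷ js) c zero {b} size≤b
  with eq (encodeℕ c) (encodeℕ (c + 0)) in e | eq-app (encodeℕ c) (encodeℕ (c + 0))
... | false | _ = contradiction
  (trans (sym e) (trans (cong (λ c′ → eq (encodeℕ c) (encodeℕ c′)) (+-identityʳ c)) (eq-refl (encodeℕ c)))) λ ()
... | true  | r = app (case-cons′ var′ (case-cons′ (call′ (var′ ∷′ var′ ∷′ []′) r) nil′)) (s≤s (begin
  size (encodeℕ (c + 0)) + 0                      ≤⟨ +-monoʳ-≤ (size (encodeℕ (c + 0))) z≤n ⟩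
  size (encodeℕ (c + 0)) + (c + suc (length js))  ≤⟨ size≤b ⟩
  b                                               ≤⟨ n≤1+n b ⟩
  suc b                                           ≤⟨ m≤m+n (suc b) _ ⟩
  suc b + length js * suc b                       ∎))
  where open ≤-Reasoning
cap-app (_ ∷ js) c (suc r) {b} size≤b
  with eq (encodeℕ c) (encodeℕ (c + suc r)) in e | eq-app (encodeℕ c) (encodeℕ (c + suc r))
     | subst (λ m → size (encodeℕ m) + (suc c + length js) ≤ b →
                    App CAP (encodeList js ∷ encodeℕ m ∷ encodeℕ (suc c) ∷ []) (unary (length js ⊓ r)) (suc (length js * suc b)))
             (sym (+-suc c r)) (cap-app js (suc c) r)
... | true  | _ | _ = contradiction (sym (encodeℕ-injective (eq-sound _ _ e))) (m+1+n≢m c)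
... | false | d | rec = app
  (case-cons′ var′ (case-nil′ (call′ (var′ ∷′ var′ ∷′ []′) d)
    (cons′ nil′ (call′ (var′ ∷′ var′ ∷′ call′ (var′ ∷′ []′) (inc-app c) ∷′ []′) (rec hyp)))))
  (s≤s (begin
    S + (suc c + 0 + suc (length js * suc b))       ≡⟨ lemma S c (length js * suc b) ⟩
    suc (S + (c + 1)) + length js * suc b           ≤⟨ +-monoˡ-≤ _ (s≤s (≤-trans (+-monoʳ-≤ S (+-monoʳ-≤ c (s≤s z≤n))) size≤b)) ⟩
    suc b + length js * suc b ∎))
  where
  open ≤-Reasoning
  S = size (encodeℕ (c + suc r))
  hyp : S + (suc c + length js) ≤ b
  hyp = ≤-trans (≤-reflexive (cong (S +_) (sym (+-suc c (length js))))) size≤b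
  lemma : ∀ S c l → S + (suc c + 0 + suc l) ≡ suc (S + (c + 1)) + l
  lemma = solve-∀

init-app : ∀ js → App INIT (encodeList js ∷ []) (init (length js)) (suc (length js))
init-app []       = app (case-nil′ var′ (cons′ nil′ nil′)) ≤-refl
init-app (_ ∷ js) =
  app (case-cons′ var′ (cons′ (call′ (var′ ∷′ []′) (init-app js)) nil′)) (s≤s (≤-reflexive (+-identityʳ _)))

full-app : ∀ js t → App FULL (encodeList js ∷ t ∷ []) (full (length js) t) (suc (length js))
full-app []       t       = app (case-nil′ var′ var′) ≤-refl
full-app (_ ∷ js) nil     = app (case-cons′ var′ (case-nil′ var′ nil′)) (s≤s z≤n)
full-app (_ ∷ js) (a ∙ b) =
  app (case-cons′ var′ (case-cons′ var′ (call′ (var′ ∷′ var′ ∷′ []′) (full-app js b)))) ≤-refl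

dec-app : ∀ js t → App DEC (encodeList js ∷ t ∷ []) (dec (length js) t) (size t)
dec-app []       nil     = app (case-nil′ var′ (case-nil′ var′ nil′)) ≤-refl
dec-app []       (h ∙ t) = app (case-nil′ var′ (case-cons′ var′ var′)) (s≤s z≤n)
dec-app (_ ∷ js) nil     = app (case-cons′ var′ (case-nil′ var′ nil′)) ≤-refl
dec-app (_ ∷ js) (a ∙ b) =
  app (case-cons′ var′ (case-cons′ var′
        (cons′ (call′ (var′ ∷′ var′ ∷′ []′) (dec-app js a)) (call′ (var′ ∷′ var′ ∷′ []′) (dec-app js b)))))
      ≤-refl

-- Bit lists as sets of jobs

mem : Tree → ℕ → Bool
mem nil           _       = false
mem (_ ∙ t)       (suc i) = mem t i
mem (nil ∙ _)     zero    = false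
mem ((_ ∙ _) ∙ _) zero    = true

unit : ℕ → Tree
unit zero    = (nil ∙ nil) ∙ nil
unit (suc i) = nil ∙ unit i

mem-unit : ∀ i j → mem (unit i) j ≡ true → i ≡ j
mem-unit zero    zero    _ = refl
mem-unit (suc i) (suc j) p = cong suc (mem-unit i j p)

mem-unit-refl : ∀ i → mem (unit i) i ≡ true
mem-unit-refl zero    = refl
mem-unit-refl (suc i) = mem-unit-refl i

mem-union : ∀ a b i → mem (union a b) i ≡ mem a i ∨ mem b i
mem-union nil           b             i       = refl
mem-union (h ∙ t)       nil           i       = sym (∨-identityʳ _)
mem-union (nil ∙ t)     (nil ∙ u)     zero    = refl
mem-union (nil ∙ t)     ((_ ∙ _) ∙ u) zero    = refl
mem-union ((_ ∙ _) ∙ t) (nil ∙ u)     zero    = refl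
mem-union ((_ ∙ _) ∙ t) ((_ ∙ _) ∙ u) zero    = refl
mem-union (_ ∙ t)       (_ ∙ u)       (suc i) = mem-union t u i

mem-unionˡ : ∀ a b i → mem a i ≡ true → mem (union a b) i ≡ true
mem-unionˡ a b i p = trans (mem-union a b i) (cong (_∨ mem b i) p)

mem-unionʳ : ∀ a b i → mem b i ≡ true → mem (union a b) i ≡ true
mem-unionʳ a b i p = trans (mem-union a b i) (trans (cong (mem a i ∨_) p) (∨-zeroʳ (mem a i)))

mem-union⁻ : ∀ a b i → mem (union a b) i ≡ true → mem a i ≡ true ⊎ mem b i ≡ true
mem-union⁻ a b i p with mem a i | trans (sym (mem-union a b i)) p
... | true  | _ = inj₁ refl
... | false | q = inj₂ q

sub-sound : ∀ a b → sub a b ≡ true → ∀ i → mem a i ≡ true → mem b i ≡ true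
sub-sound (nil ∙ t)     nil           p (suc i) q = contradiction (sub-sound t nil p i q) λ ()
sub-sound (nil ∙ t)     (_ ∙ u)       p (suc i) q = sub-sound t u p i q
sub-sound ((_ ∙ _) ∙ t) ((_ ∙ _) ∙ u) p zero    q = refl
sub-sound ((_ ∙ _) ∙ t) ((_ ∙ _) ∙ u) p (suc i) q = sub-sound t u p i q

sub-complete : ∀ a b → (∀ i → mem a i ≡ true → mem b i ≡ true) → sub a b ≡ true
sub-complete nil           b             _ = refl
sub-complete (nil ∙ t)     nil           f = sub-complete t nil (λ i p → contradiction (f (suc i) p) λ ())
sub-complete (nil ∙ t)     (_ ∙ u)       f = sub-complete t u (f ∘ suc)
sub-complete ((_ ∙ _) ∙ t) nil           f = contradiction (f 0 refl) λ ()
sub-complete ((_ ∙ _) ∙ t) (nil ∙ u)     f = contradiction (f 0 refl) λ ()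
sub-complete ((_ ∙ _) ∙ t) ((_ ∙ _) ∙ u) f = sub-complete t u (f ∘ suc)

bits : List Bool → Tree
bits = encodeList ∘ map encodeBool

mem-bits : ∀ {n} (f : Fin n → Bool) w → mem (bits (tabulate f)) (toℕ w) ≡ f w
mem-bits f zero    with f zero
... | false = refl
... | true  = refl
mem-bits f (suc w) with f zero
... | false = mem-bits (f ∘ suc) w
... | true  = mem-bits (f ∘ suc) w

mem-bits⁻ : ∀ {n} (f : Fin n → Bool) i → mem (bits (tabulate f)) i ≡ true → ∃[ w ] (toℕ w ≡ i × f w ≡ true)
mem-bits⁻ {suc n} f zero    p with f zero in e
... | true = zero , refl , e
mem-bits⁻ {suc n} f (suc i) p with f zero
... | false = let w , q , r = mem-bits⁻ (f ∘ suc) i p in suc w , cong suc q , r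
... | true  = let w , q , r = mem-bits⁻ (f ∘ suc) i p in suc w , cong suc q , r

size-unary : ∀ k → size (unary k) ≡ suc (2 * k)
size-unary zero    = refl
size-unary (suc k) = trans (cong (2 +_) (size-unary k)) (lemma k)
  where
  lemma : ∀ k → 2 + suc (2 * k) ≡ suc (2 * suc k)
  lemma = solve-∀

size-unit : ∀ i → size (unit i) ≡ 2 * i + 5
size-unit zero    = refl
size-unit (suc i) = trans (cong (2 +_) (size-unit i)) (lemma i)
  where
  lemma : ∀ i → 2 + (2 * i + 5) ≡ 2 * suc i + 5
  lemma = solve-∀

union-unary : ∀ a b → union (unary a) (unary b) ≡ unary (a ⊔ b)
union-unary zero    b       = refl
union-unary (suc a) zero    = refl
union-unary (suc a) (suc b) = cong (nil ∙_) (union-unary a b)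

size-∈ : ∀ {n} (f : Fin n → Tree) w → size (f w) ≤ size (encodeList (tabulate f))
size-∈ f zero    = ≤-trans (m≤m+n _ _) (n≤1+n _)
size-∈ f (suc w) = ≤-trans (size-∈ (f ∘ suc) w) (≤-trans (m≤n+m _ (size (f zero))) (n≤1+n _))

length≤size : ∀ ts → length ts ≤ size (encodeList ts)
length≤size []       = z≤n
length≤size (t ∷ ts) = s≤s (≤-trans (length≤size ts) (m≤n+m _ (size t)))

-- Cardinalities of lists and subsets

unique-lookup : ∀ {A : Set} {xs : List A} → Unique xs → ∀ {i j} → List.lookup xs i ≡ List.lookup xs j → i ≡ j
unique-lookup (_ ∷ _)  {zero}  {zero}  _ = refl
unique-lookup (x∉ ∷ _) {zero}  {suc j} p = contradiction p (All.lookup x∉ (∈-lookup j))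
unique-lookup (x∉ ∷ _) {suc i} {zero}  p = contradiction (sym p) (All.lookup x∉ (∈-lookup i))
unique-lookup (_ ∷ u)  {suc i} {suc j} p = cong suc (unique-lookup u p)

unique⇒length≤ : ∀ {A : Set} {xs ys : List A} → Unique xs → (∀ {x} → x ∈ xs → x ∈ ys) → length xs ≤ length ys
unique⇒length≤ {xs = xs} {ys} u f = Fin.injective⇒≤ {f = λ i → index (f (∈-lookup {xs = xs} i))} λ {i} {j} p →
  unique-lookup u (trans (lookup-index (f (∈-lookup {xs = xs} i)))
                         (trans (cong (List.lookup ys) p) (sym (lookup-index (f (∈-lookup {xs = xs} j))))))

members : ∀ {n} → Subset n → List (Fin n)
members []            = []
members (outside ∷ p) = map suc (members p)
members (inside  ∷ p) = zero ∷ map suc (members p)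

length-members : ∀ {n} (p : Subset n) → length (members p) ≡ ∣ p ∣
length-members []            = refl
length-members (outside ∷ p) = trans (length-map suc (members p)) (length-members p)
length-members (inside  ∷ p) = cong suc (trans (length-map suc (members p)) (length-members p))

unique-members : ∀ {n} (p : Subset n) → Unique (members p)
unique-members []            = []
unique-members (outside ∷ p) = Unique.map⁺ Fin.suc-injective (unique-members p)
unique-members (inside  ∷ p) =
  All.tabulate (λ x∈ 0≡x → contradiction (trans 0≡x (proj₂ (proj₂ (∈-map⁻ suc x∈)))) λ ())
  ∷ Unique.map⁺ Fin.suc-injective (unique-members p)

∈-members⁺ : ∀ {n} {x : Fin n} {p} → x Subset.∈ p → x ∈ members p
∈-members⁺ {p = inside  ∷ p} Vec.here      = here refl
∈-members⁺ {p = outside ∷ p} (Vec.there x) = ∈-map⁺ suc (∈-members⁺ x)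
∈-members⁺ {p = inside  ∷ p} (Vec.there x) = there (∈-map⁺ suc (∈-members⁺ x))

∈-members⁻ : ∀ {n} {x : Fin n} p → x ∈ members p → x Subset.∈ p
∈-members⁻ (outside ∷ p) x∈ with y , y∈ , refl ← ∈-map⁻ suc x∈ = Vec.there (∈-members⁻ p y∈)
∈-members⁻ (inside  ∷ p) (here refl) = Vec.here
∈-members⁻ (inside  ∷ p) (there x∈) with y , y∈ , refl ← ∈-map⁻ suc x∈ = Vec.there (∈-members⁻ p y∈)

∣p∣≤length : ∀ {n} (p : Subset n) xs → (∀ {x} → x Subset.∈ p → x ∈ xs) → ∣ p ∣ ≤ length xs
∣p∣≤length p xs f = subst (_≤ length xs) (length-members p) (unique⇒length≤ (unique-members p) (f ∘ ∈-members⁻ p))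

length≤∣p∣ : ∀ {n} (p : Subset n) {xs} → Unique xs → (∀ {x} → x ∈ xs → x Subset.∈ p) → length xs ≤ ∣ p ∣
length≤∣p∣ p {xs} u f = subst (length xs ≤_) (length-members p) (unique⇒length≤ u (∈-members⁺ ∘ f))

⟪_⟫ : ∀ {n} {P : Fin n → Set} → Decidable P → Subset n
⟪ P? ⟫ = Vec.tabulate (does ∘ P?)

∈-⟪⟫⁺ : ∀ {n} {P : Fin n → Set} (P? : Decidable P) {v} → P v → v Subset.∈ ⟪ P? ⟫
∈-⟪⟫⁺ P? {v} p = lookup⇒[]= v _ (trans (lookup∘tabulate (does ∘ P?) v) (dec-true (P? v) p))

∈-⟪⟫⁻ : ∀ {n} {P : Fin n → Set} (P? : Decidable P) {v} → v Subset.∈ ⟪ P? ⟫ → P v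
∈-⟪⟫⁻ P? {v} v∈ with P? v in e
... | yes p = p
... | no  _ = contradiction
  (trans (sym (cong does e)) (trans (sym (lookup∘tabulate (does ∘ P?) v)) ([]=⇒lookup v∈))) λ ()

level : ∀ {n} → (Fin n → ℕ) → ℕ → Subset n
level layer t = ⟪ (λ v → layer v ℕ.≟ t) ⟫

∈-level⁺ : ∀ {n} (layer : Fin n → ℕ) t {v} → layer v ≡ t → v Subset.∈ level layer t
∈-level⁺ layer t = ∈-⟪⟫⁺ λ v → layer v ℕ.≟ t

∈-level⁻ : ∀ {n} (layer : Fin n → ℕ) t {v} → v Subset.∈ level layer t → layer v ≡ t
∈-level⁻ layer t = ∈-⟪⟫⁻ λ v → layer v ℕ.≟ t

-- Tries as functions on paths

height : Tree → ℕ
height nil     = 0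
height (_ ∙ t) = suc (height t)

-- Absent sets get 0 and present ones one more than their budget. So `union` becomes the maximum and
-- `dec` the predecessor, and a set without a free machine drops out of the family under `dec`.
val : ∀ {d} → Tree → Vec Bool d → ℕ
val t       []          = height t
val nil     (_ ∷ _)     = 0
val (a ∙ _) (false ∷ p) = val a p
val (_ ∙ b) (true  ∷ p) = val b p

height-unary : ∀ k → height (unary k) ≡ k
height-unary zero    = refl
height-unary (suc k) = cong suc (height-unary k)

height-union : ∀ a b → height (union a b) ≡ height a ⊔ height b
height-union nil     b       = refl
height-union (h ∙ t) nil     = refl
height-union (h ∙ t) (g ∙ u) = cong suc (height-union t u)

val-nil : ∀ {d} (q : Vec Bool d) → val nil q ≡ 0
val-nil []      = refl
val-nil (_ ∷ _) = refl

val-union : ∀ {d} a b (q : Vec Bool d) → val (union a b) q ≡ val a q ⊔ val b q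
val-union a       b       []          = height-union a b
val-union nil     b       (_ ∷ _)     = refl
val-union (h ∙ t) nil     (x ∷ q)     = sym (⊔-identityʳ _)
val-union (h ∙ t) (g ∙ u) (false ∷ q) = val-union h g q
val-union (h ∙ t) (g ∙ u) (true  ∷ q) = val-union t u q

val-dec : ∀ {d} t (q : Vec Bool d) → val (dec d t) q ≡ pred (val t q)
val-dec nil     []          = refl
val-dec (_ ∙ _) []          = refl
val-dec nil     (_ ∷ _)     = refl
val-dec (a ∙ b) (false ∷ q) = val-dec a q
val-dec (a ∙ b) (true  ∷ q) = val-dec b q

val-full : ∀ d t → height (full d t) ≡ val t (Vec.replicate d true)
val-full zero    t       = refl
val-full (suc d) nil     = refl
val-full (suc d) (a ∙ b) = val-full d b

-- A path encodes the set of the jobs at which it is true.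
data At {A : Set} (v : A) : (js : List A) → Vec Bool (length js) → Set where
  here  : ∀ {js p} → At v (v ∷ js) (true ∷ p)
  there : ∀ {j js x p} → At v js p → At v (j ∷ js) (x ∷ p)

at? : ∀ {n} (v : Fin n) js p → Dec (At v js p)
at? v []       []      = no λ ()
at? v (j ∷ js) (x ∷ p) with at? v js p
... | yes a = yes (there a)
at? v (j ∷ js) (false ∷ p) | no ¬a = no λ { (there a) → ¬a a }
at? v (j ∷ js) (true ∷ p)  | no ¬a with v Fin.≟ j
... | yes refl = yes here
... | no  v≢j  = no λ { here → v≢j refl ; (there a) → ¬a a }

path : ∀ {A : Set} → (A → Bool) → (js : List A) → Vec Bool (length js)
path U []       = []
path U (j ∷ js) = U j ∷ path U js

path-true : ∀ {A : Set} {U : A → Bool} js → (∀ v → U v ≡ true) → path U js ≡ Vec.replicate (length js) true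
path-true []       f = refl
path-true (j ∷ js) f = cong₂ _∷_ (f j) (path-true js f)

at-true : ∀ {A : Set} {v : A} {js} → v ∈ js → At v js (Vec.replicate (length js) true)
at-true (here refl) = here
at-true (there v∈)  = there (at-true v∈)

init-sound : ∀ {A : Set} {v : A} js q → 0 < val (init (length js)) q → ¬ At v js q
init-sound (j ∷ js) (false ∷ q) p (there a) = init-sound js q p a
init-sound (j ∷ js) (true  ∷ q) p _         = contradiction (subst (0 <_) (val-nil q) p) λ ()

init-complete : ∀ {A : Set} {U : A → Bool} js → (∀ v → U v ≡ false) → 0 < val (init (length js)) (path U js)
init-complete []       f = s≤s z≤n
init-complete (j ∷ js) f rewrite f j = init-complete js f

∈-allSubsets : ∀ {n} (p : Subset n) → p ∈ allSubsets n
∈-allSubsets []                    = here refl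
∈-allSubsets {suc n} (outside ∷ p) = ∈-++⁺ˡ (∈-map⁺ (outside ∷_) (∈-allSubsets p))
∈-allSubsets {suc n} (inside  ∷ p) = ∈-++⁺ʳ (map (outside ∷_) (allSubsets n)) (∈-map⁺ (inside ∷_) (∈-allSubsets p))

-- Rows, closure and the order of the jobs

module Solving (I : Instance) where
  open Instance I
  private module ≺ = IsDecStrictPartialOrder isDecSPO

  row : Fin n → Tree
  row j = encodeList (map (λ w → encodeBool (does (j ≺? w))) (allFin n))

  private
    row-bits : ∀ j → row j ≡ bits (tabulate (λ w → does (j ≺? w)))
    row-bits j = cong encodeList (trans (map-tabulate id (λ w → encodeBool (does (j ≺? w))))
                                        (sym (map-tabulate (λ w → does (j ≺? w)) encodeBool)))

  mem-row : ∀ {j w} → j ≺ w → mem (row j) (toℕ w) ≡ true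
  mem-row {j} {w} p = trans (cong (λ t → mem t (toℕ w)) (row-bits j)) (trans (mem-bits _ w) (dec-true (j ≺? w) p))

  mem-row⁻ : ∀ {j} i → mem (row j) i ≡ true → ∃[ w ] (toℕ w ≡ i × j ≺ w)
  mem-row⁻ {j} i p with mem-bits⁻ (λ w → does (j ≺? w)) i (trans (cong (λ t → mem t i) (sym (row-bits j))) p)
  ... | w , q , r with j ≺? w
  ...   | yes j≺w = w , q , j≺w

  -- A singleton lies in a row exactly when its element is a successor, so `INSERT` can use `SUB` as
  -- the order test.
  sub-unit-row : ∀ x y → sub (unit (toℕ x)) (row y) ≡ does (y ≺? x)
  sub-unit-row x y with y ≺? x
  ... | yes y≺x = sub-complete (unit (toℕ x)) (row y) λ i p →
    subst (λ i → mem (row y) i ≡ true) (mem-unit (toℕ x) i p) (mem-row y≺x)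
  ... | no y⊀x with sub (unit (toℕ x)) (row y) in e
  ...   | false = refl
  ...   | true with mem-row⁻ (toℕ x) (sub-sound (unit (toℕ x)) (row y) e (toℕ x) (mem-unit-refl (toℕ x)))
  ...     | w , q , y≺w = contradiction (subst (y ≺_) (Fin.toℕ-injective q) y≺w) y⊀x

  closed : Fin n → Tree → Bool
  closed j D = sub (row j) D

  closed-sound : ∀ {j D} → closed j D ≡ true → ∀ {w} → j ≺ w → mem D (toℕ w) ≡ true
  closed-sound {j} {D} p {w} j≺w = sub-sound (row j) D p (toℕ w) (mem-row j≺w)

  closed-complete : ∀ {j D} → (∀ w → j ≺ w → mem D (toℕ w) ≡ true) → closed j D ≡ true
  closed-complete {j} {D} f = sub-complete (row j) D λ i p →
    let w , q , j≺w = mem-row⁻ i p in subst (λ i → mem D i ≡ true) q (f w j≺w)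

  -- Every job comes after its successors.
  insert : Fin n → List (Fin n) → List (Fin n)
  insert x []       = x ∷ []
  insert x (y ∷ ys) = if does (y ≺? x) then x ∷ y ∷ ys else y ∷ insert x ys

  sort : List (Fin n) → List (Fin n)
  sort = foldr insert []

  -- One pass and the size of its tries

  -- `D` holds the old jobs on the path so far. Leaves restart at `w`, since a new slot has all
  -- machines free. If `j` is not closed, `b` is discarded; in a trie that `Fits` it is `nil` there
  -- anyway.
  step : ℕ → List (Fin n) → Tree → Tree → Tree
  step w []       D nil     = nil
  step w []       D (_ ∙ _) = unary w
  step w (j ∷ js) D nil     = nil
  step w (j ∷ js) D (a ∙ b) =
    if closed j D
    then step w js D a ∙ union (step w js (union (unit (toℕ j)) D) b) (dec (length js) (step w js D a))
    else step w js D a ∙ nil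

  -- The number of ways to extend `D` through `js`, each job entering only after its successors. It
  -- follows the recursion of the tries, so sizes can be bounded node by node; the comparison with
  -- antichains comes through `upsets`.
  leaves : List (Fin n) → Tree → ℕ
  leaves []       D = 1
  leaves (j ∷ js) D = leaves js D + (if closed j D then leaves js (union (unit (toℕ j)) D) else 0)

  -- The tries whose paths add a job only after all of its successors.
  data Fits (w : ℕ) : List (Fin n) → Tree → Tree → Set where
    leaf : ∀ {D h} → h ≤ w → Fits w [] D (unary h)
    none : ∀ {j js D} → Fits w (j ∷ js) D nil
    out  : ∀ {j js D a} → Fits w js D a → Fits w (j ∷ js) D (a ∙ nil)
    both : ∀ {j js D a b} → closed j D ≡ true → Fits w js D a → Fits w js (union (unit (toℕ j)) D) b →
           Fits w (j ∷ js) D (a ∙ b)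

  _⊑_ : Tree → Tree → Set
  D ⊑ E = ∀ i → mem D i ≡ true → mem E i ≡ true

  union-⊑ : ∀ a {D E} → D ⊑ E → union a D ⊑ union a E
  union-⊑ a {D} {E} f i p with mem-union⁻ a D i p
  ... | inj₁ q = mem-unionˡ a E i q
  ... | inj₂ q = mem-unionʳ a E i (f i q)

  closed-mono : ∀ {j D E} → D ⊑ E → closed j D ≡ true → closed j E ≡ true
  closed-mono f p = closed-complete λ w j≺w → f (toℕ w) (closed-sound p j≺w)

  -- Sets copied from the side without `j` to the side with `j` were built over `D` and must now fit
  -- over `D` together with `j`.
  fits-mono : ∀ {w js D E t} → D ⊑ E → Fits w js D t → Fits w js E t
  fits-mono f (leaf h)             = leaf h
  fits-mono f none                 = none
  fits-mono f (out a)              = out (fits-mono f a)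
  fits-mono f (both {j = j} c a b) = both (closed-mono f c) (fits-mono f a) (fits-mono (union-⊑ (unit (toℕ j)) f) b)

  fits-union : ∀ {w js D a b} → Fits w js D a → Fits w js D b → Fits w js D (union a b)
  fits-union {w} {D = D} (leaf {h = h} p) (leaf {h = k} q) =
    subst (Fits w [] D) (sym (union-unary h k)) (leaf (⊔-lub p q))
  fits-union none         b             = b
  fits-union (out a)      none          = out a
  fits-union (both c a b) none          = both c a b
  fits-union (out a)      (out a′)      = out (fits-union a a′)
  fits-union (out a)      (both c a′ b) = both c (fits-union a a′) b
  fits-union (both {b = nil} c a b) (out a′)        = both c (fits-union a a′) b
  fits-union (both {b = _ ∙ _} c a b) (out a′)      = both c (fits-union a a′) b
  fits-union (both c a b) (both _ a′ b′) = both c (fits-union a a′) (fits-union b b′)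

  fits-dec : ∀ {w js D t} → Fits w js D t → Fits w js D (dec (length js) t)
  fits-dec (leaf {h = zero}  p) = leaf {h = zero} p
  fits-dec (leaf {h = suc h} p) = leaf (≤-trans (n≤1+n h) p)
  fits-dec none                 = none
  fits-dec {js = _ ∷ []}     (out a) = out (fits-dec a)
  fits-dec {js = _ ∷ _ ∷ _}  (out a) = out (fits-dec a)
  fits-dec (both c a b)         = both c (fits-dec a) (fits-dec b)

  fits-step : ∀ w js D t → Fits w js D (step w js D t)
  fits-step w []       D nil     = leaf {h = 0} z≤n
  fits-step w []       D (_ ∙ _) = leaf ≤-refl
  fits-step w (j ∷ js) D nil     = none
  fits-step w (j ∷ js) D (a ∙ b) with closed j D in c
  ... | false = out (fits-step w js D a)
  ... | true  = both c o (fits-union (fits-step w js (union e D) b) (fits-mono (mem-unionʳ e D) (fits-dec o)))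
    where
    e = unit (toℕ j)
    o = fits-step w js D a

  leaves-pos : ∀ js D → 1 ≤ leaves js D
  leaves-pos []       D = ≤-refl
  leaves-pos (j ∷ js) D = ≤-trans (leaves-pos js D) (m≤m+n _ _)

  -- Each leaf pays for its own path: two tree nodes per level, the second for the empty sibling in
  -- `out`, and `size (unary w)` at the end. Every prefix has a leaf to charge, because adding no
  -- further job completes it.
  fits-size : ∀ {w js D t} → Fits w js D t → size t ≤ (2 * length js + size (unary w)) * leaves js D
  fits-size {w} (leaf {h = h} h≤w) = begin
    size (unary h)      ≡⟨ size-unary h ⟩
    suc (2 * h)         ≤⟨ s≤s (*-monoʳ-≤ 2 h≤w) ⟩
    suc (2 * w)         ≡⟨ size-unary w ⟨
    size (unary w)      ≡⟨ *-identityʳ _ ⟨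
    size (unary w) * 1  ∎
    where open ≤-Reasoning
  fits-size {w} {j ∷ js} {D} none =
    *-mono-≤ {1} {_} {1} (≤-trans (size-pos (unary w)) (m≤n+m _ (2 * suc (length js)))) (leaves-pos (j ∷ js) D)
  fits-size {w} {j ∷ js} {D} (out {a = a} fa) = begin
    suc (size a + 1)                  ≡⟨ lemma (size a) ⟩
    2 * 1 + size a                    ≤⟨ +-mono-≤ (*-monoʳ-≤ 2 (leaves-pos js D)) (fits-size fa) ⟩
    2 * l + (2 * d + W) * l           ≡⟨ lemma′ d W l ⟩
    (2 * suc d + W) * l               ≤⟨ *-monoʳ-≤ (2 * suc d + W) (m≤m+n l _) ⟩
    (2 * suc d + W) * leaves (j ∷ js) D ∎
    where
    open ≤-Reasoning
    l = leaves js D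
    d = length js
    W = size (unary w)
    lemma : ∀ a → suc (a + 1) ≡ 2 * 1 + a
    lemma = solve-∀
    lemma′ : ∀ d W l → 2 * l + (2 * d + W) * l ≡ (2 * suc d + W) * l
    lemma′ = solve-∀
  fits-size {w} {j ∷ js} {D} (both {a = a} {b} c fa fb) rewrite c = begin
    1 + (size a + size b)             ≤⟨ +-mono-≤ {1} {2 * (l + k)} (≤-trans (s≤s z≤n) (*-monoʳ-≤ 2 (≤-trans (leaves-pos js D) (m≤m+n l k))))
                                                   (+-mono-≤ (fits-size fa) (fits-size fb)) ⟩
    2 * (l + k) + ((2 * d + W) * l + (2 * d + W) * k) ≡⟨ lemma d W l k ⟩
    (2 * suc d + W) * (l + k) ∎
    where
    open ≤-Reasoning
    l = leaves js D
    k = leaves js (union (unit (toℕ j)) D)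
    d = length js
    W = size (unary w)
    lemma : ∀ d W l k → 2 * (l + k) + ((2 * d + W) * l + (2 * d + W) * k) ≡ (2 * suc d + W) * (l + k)
    lemma = solve-∀

  insert-↭ : ∀ x ys → insert x ys ↭ x ∷ ys
  insert-↭ x []       = ↭-refl
  insert-↭ x (y ∷ ys) with does (y ≺? x)
  ... | true  = ↭-refl
  ... | false = ↭-trans (prep y (insert-↭ x ys)) (swap y x ↭-refl)

  sort-↭ : ∀ xs → sort xs ↭ xs
  sort-↭ []       = ↭-refl
  sort-↭ (x ∷ xs) = ↭-trans (insert-↭ x (sort xs)) (prep x (sort-↭ xs))

  -- Calls made on an encoded instance

  job : Fin n → Tree
  job j = unit (toℕ j) ∙ row j

  jobs : List (Fin n) → Tree
  jobs js = encodeList (map job js)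

  js : List (Fin n)
  js = sort (allFin n)

  length-js : length js ≡ n
  length-js = trans (↭-length (sort-↭ (allFin n))) (length-tabulate {n = n} id)

  N : ℕ
  N = size (encodeInstance I)

  n≤N : n ≤ N
  n≤N = begin
    n                                   ≡⟨ length-tabulate {n = n} id ⟨
    length (allFin n)                   ≡⟨ length-map row (allFin n) ⟨
    length (map row (allFin n))         ≤⟨ length≤size (map row (allFin n)) ⟩
    size (encodeList (map row (allFin n))) ≤⟨ m≤n+m _ (suc (size (encodeℕ m))) ⟩
    N                                   ∎
    where open ≤-Reasoning

  1≤N : 1 ≤ N
  1≤N = s≤s z≤n

  size-m : size (encodeℕ m) ≤ N
  size-m = ≤-trans (m≤m+n _ _) (n≤1+n _)

  size-row : ∀ j → size (row j) ≤ N
  size-row j = begin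
    size (row j)                              ≤⟨ size-∈ row j ⟩
    size (encodeList (tabulate row))          ≡⟨ cong (size ∘ encodeList) (map-tabulate id row) ⟨
    size (encodeList (map row (allFin n)))    ≤⟨ m≤n+m _ (suc (size (encodeℕ m))) ⟩
    N                                         ∎
    where open ≤-Reasoning

  -- A row has size at most `N` and a `unit` at most 2n + 5, where `1 ≤ N` absorbs the 5.
  R : ℕ
  R = 7 * N

  row≤R : ∀ j → size (row j) ≤ R
  row≤R j = ≤-trans (size-row j) (m≤n*m N 7)

  unit≤R : ∀ (j : Fin n) → size (unit (toℕ j)) ≤ R
  unit≤R j = begin
    size (unit (toℕ j))  ≡⟨ size-unit (toℕ j) ⟩
    2 * toℕ j + 5 * 1    ≤⟨ +-mono-≤ (*-monoʳ-≤ 2 (≤-trans (<⇒≤ (Fin.toℕ<n j)) n≤N)) (*-monoʳ-≤ 5 1≤N) ⟩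
    2 * N + 5 * N        ≡⟨ *-distribʳ-+ N 2 5 ⟨
    R                    ∎
    where open ≤-Reasoning

  ≺-app : ∀ x y → App SUB (unit (toℕ x) ∷ row y ∷ []) (encodeBool (does (y ≺? x))) (size (unit (toℕ x)))
  ≺-app x y = subst (λ b → App SUB (unit (toℕ x) ∷ row y ∷ []) (encodeBool b) (size (unit (toℕ x))))
                    (sub-unit-row x y) (sub-app (unit (toℕ x)) (row y))

  insert-app : ∀ x ys → App INSERT (unit (toℕ x) ∷ row x ∷ jobs ys ∷ []) (jobs (insert x ys)) (suc (length ys * suc R))
  insert-app x []       = app (case-nil′ var′ (cons′ (cons′ var′ var′) nil′)) ≤-refl
  insert-app x (y ∷ ys) with does (y ≺? x) | ≺-app x y
  ... | true  | d = app
    (case-cons′ var′ (case-cons′ var′ (case-cons′ (call′ (var′ ∷′ var′ ∷′ []′) d) (cons′ (cons′ var′ var′) var′))))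
    (s≤s (begin
      size (unit (toℕ x)) + 0       ≡⟨ +-identityʳ _ ⟩
      size (unit (toℕ x))           ≤⟨ unit≤R x ⟩
      R                             ≤⟨ n≤1+n R ⟩
      suc R                         ≤⟨ m≤m+n (suc R) _ ⟩
      suc R + length ys * suc R     ∎))
    where open ≤-Reasoning
  ... | false | d = app
    (case-cons′ var′ (case-cons′ var′ (case-nil′ (call′ (var′ ∷′ var′ ∷′ []′) d)
      (cons′ var′ (call′ (var′ ∷′ var′ ∷′ var′ ∷′ []′) (insert-app x ys))))))
    (s≤s (begin
      size (unit (toℕ x)) + suc (length ys * suc R)  ≤⟨ +-monoˡ-≤ _ (unit≤R x) ⟩
      R + suc (length ys * suc R)                    ≡⟨ +-suc R _ ⟩
      suc R + length ys * suc R                      ∎))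
    where open ≤-Reasoning

  -- Rows carry no index, so `unit k` counts along; hence the generalisation to a segment of jobs
  -- that starts at `k`. `L` bounds all tails at once, so that every insertion has the same price.
  mk-app : ∀ {l L k} (f : Fin l → Fin n) → l ≤ L → (∀ i → toℕ (f i) ≡ k + toℕ i) →
           App MK (encodeList (map row (tabulate f)) ∷ unit k ∷ []) (jobs (sort (tabulate f)))
               (suc (l * (2 + L * suc R)))
  mk-app {zero}      f _   _  = app (case-nil′ var′ nil′) ≤-refl
  mk-app {suc l} {L} {k} f l<L f≡ = app
    (case-cons′ var′ (call′ (var′ ∷′ var′ ∷′ call′ (var′ ∷′ cons′ nil′ var′ ∷′ []′) rest ∷′ []′)
      (subst (λ i → App INSERT (unit i ∷ row (f zero) ∷ jobs tail ∷ []) (jobs (insert (f zero) tail)) (suc (length tail * suc R)))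
             (trans (f≡ zero) (+-identityʳ k)) (insert-app (f zero) tail))))
    (s≤s (begin
      suc (l * b) + 0 + suc (length tail * suc R)  ≤⟨ +-monoʳ-≤ (suc (l * b) + 0) (s≤s (*-monoˡ-≤ (suc R) tail≤L)) ⟩
      suc (l * b) + 0 + suc (L * suc R)            ≡⟨ lemma (l * b) (L * suc R) ⟩
      b + l * b                                    ∎))
    where
    open ≤-Reasoning
    b = 2 + L * suc R
    tail = sort (tabulate (f ∘ suc))
    rest = mk-app {l} {L} {suc k} (f ∘ suc) (<⇒≤ l<L) λ i → trans (f≡ (suc i)) (+-suc k (toℕ i))
    tail≤L : length tail ≤ L
    tail≤L = ≤-trans (≤-reflexive (trans (↭-length (sort-↭ (tabulate (f ∘ suc)))) (length-tabulate (f ∘ suc)))) (<⇒≤ l<L)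
    lemma : ∀ x y → suc x + 0 + suc y ≡ 2 + y + x
    lemma = solve-∀

  closed-app : ∀ j D → App SUB (row j ∷ D ∷ []) (encodeBool (closed j D)) (size (row j))
  closed-app j D = sub-app (row j) D

  private
    shrink : ∀ d {W X} → 2 * suc d + W ≤ X → 2 * d + W ≤ X
    shrink d {W} = ≤-trans (+-monoˡ-≤ W (*-monoʳ-≤ 2 (n≤1+n d)))

  -- At one node the closure test and the addition of `j` to `D` cost at most `R` each, while
  -- decreasing and merging cost the sizes of the two results, at most `X` per leaf by `fits-size`.
  -- The leaves of both branches add up to `leaves`, so each of the `suc (length js)` levels costs
  -- the same. The result for `a` is bound once and used on both sides.
  step-app : ∀ {w X} js D t → 2 * length js + size (unary w) ≤ X →
             App STEP (jobs js ∷ D ∷ t ∷ unary w ∷ []) (step w js D t)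
                 (suc (length js) * ((1 + R + R + X) * leaves js D))
  step-app []       D nil     _ = app (case-nil′ var′ (case-nil′ var′ nil′)) (s≤s z≤n)
  step-app []       D (_ ∙ _) _ = app (case-nil′ var′ (case-cons′ var′ var′)) (s≤s z≤n)
  step-app {w} {X} (j ∷ js) D nil     _ = app (case-cons′ var′ (case-nil′ var′ nil′))
    (*-mono-≤ {1} {suc (length (j ∷ js))} {1} (s≤s z≤n) (*-mono-≤ {1} {1 + R + R + X} {1} (s≤s z≤n) (leaves-pos (j ∷ js) D)))
  step-app {w} {X} (j ∷ js) D (a ∙ b) size≤X
    with closed j D | closed-app j D
  ... | false | c = app
    (case-cons′ var′ (case-cons′ var′ (bind′ (call′ (var′ ∷′ var′ ∷′ var′ ∷′ var′ ∷′ []′) (step-app js D a (shrink (length js) size≤X)))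
      (case-cons′ var′ (case-nil′ (call′ (var′ ∷′ var′ ∷′ []′) c) (cons′ var′ nil′))))))
    (begin
      suc (d * (Q * l) + (size (row j) + 0))   ≡⟨ lemma (d * (Q * l)) (size (row j)) ⟩
      (1 + size (row j)) * 1 + d * (Q * l)     ≤⟨ +-monoˡ-≤ _ (*-mono-≤ 1+row≤Q (leaves-pos js D)) ⟩
      Q * l + d * (Q * l)                      ≡⟨⟩
      suc d * (Q * l)                          ≡⟨ cong (λ x → suc d * (Q * x)) (+-identityʳ l) ⟨
      suc d * (Q * (l + 0))                    ∎)
    where
    open ≤-Reasoning
    d = suc (length js)
    Q = 1 + R + R + X
    l = leaves js D
    1+row≤Q : 1 + size (row j) ≤ Q
    1+row≤Q = s≤s (≤-trans (row≤R j) (≤-trans (m≤m+n R R) (m≤m+n (R + R) X)))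
    lemma : ∀ x y → suc (x + (y + 0)) ≡ (1 + y) * 1 + x
    lemma = solve-∀
  ... | true  | c = app
    (case-cons′ var′ (case-cons′ var′ (bind′ (call′ (var′ ∷′ var′ ∷′ var′ ∷′ var′ ∷′ []′) (step-app js D a (shrink (length js) size≤X)))
      (case-cons′ var′ (case-cons′ (call′ (var′ ∷′ var′ ∷′ []′) c)
        (cons′ var′ (call′
          (call′ (var′ ∷′ call′ (var′ ∷′ var′ ∷′ []′) (union-app (unit (toℕ j)) D) ∷′ var′ ∷′ var′ ∷′ []′) (step-app js (union (unit (toℕ j)) D) b (shrink (length js) size≤X)) ∷′
           call′ (var′ ∷′ var′ ∷′ []′) (subst (λ d → App DEC (jobs js ∷ step w js D a ∷ []) (dec d (step w js D a)) (size (step w js D a)))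
                                              (length-map job js) (dec-app (map job js) (step w js D a))) ∷′ []′)
          (union-app (step w js (union (unit (toℕ j)) D) b) (dec (length js) (step w js D a))))))))))
    (begin
      suc (d * (Q * l) + (size (row j) + (size e + 0 + d * (Q * k) + (size sa + 0) + size sb)))
        ≡⟨ lemma d (Q * l) (size (row j)) (size e) (Q * k) (size sa) (size sb) ⟩
      (1 + size (row j) + size e) * 1 + (size sa + size sb) + d * (Q * l + Q * k)
        ≤⟨ +-monoˡ-≤ _ (+-mono-≤ (*-mono-≤ (+-mono-≤ (s≤s (row≤R j)) (unit≤R j)) (≤-trans (leaves-pos js D) (m≤m+n l k)))
                                  (+-mono-≤ a≤ b≤)) ⟩
      (1 + R + R) * (l + k) + (X * l + X * k) + d * (Q * l + Q * k)
        ≡⟨ lemma′ d R X l k ⟩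
      suc d * (Q * (l + k)) ∎)
    where
    open ≤-Reasoning
    e = unit (toℕ j)
    d = suc (length js)
    Q = 1 + R + R + X
    l = leaves js D
    k = leaves js (union e D)
    sa = step w js D a
    sb = step w js (union e D) b
    size≤X′ = shrink (length js) size≤X
    a≤ : size sa ≤ X * l
    a≤ = ≤-trans (fits-size (fits-step w js D a)) (*-monoˡ-≤ l size≤X′)
    b≤ : size sb ≤ X * k
    b≤ = ≤-trans (fits-size (fits-step w js (union e D) b)) (*-monoˡ-≤ k size≤X′)
    lemma : ∀ d x r e y p q → suc (d * x + (r + (e + 0 + d * y + (p + 0) + q))) ≡ (1 + r + e) * 1 + (p + q) + d * (x + y)
    lemma = solve-∀
    lemma′ : ∀ d R X l k → (1 + R + R) * (l + k) + (X * l + X * k) + d * ((1 + R + R + X) * l + (1 + R + R + X) * k) ≡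
                           suc d * ((1 + R + R + X) * (l + k))
    lemma′ = solve-∀

  -- Correctness of one pass

  -- One time slot: Move js D p q s says that s jobs are added to the set p,
  -- giving q, where D are the jobs of p that precede js.
  data Move : (js : List (Fin n)) → Tree → Vec Bool (length js) → Vec Bool (length js) → ℕ → Set where
    []   : ∀ {D} → Move [] D [] [] 0
    skip : ∀ {j js D p q s} → Move js D p q s → Move (j ∷ js) D (false ∷ p) (false ∷ q) s
    keep : ∀ {j js D p q s} → closed j D ≡ true → Move js (union (unit (toℕ j)) D) p q s →
           Move (j ∷ js) D (true ∷ p) (true ∷ q) s
    add  : ∀ {j js D p q s} → closed j D ≡ true → Move js D p q s →
           Move (j ∷ js) D (false ∷ p) (true ∷ q) (suc s)

  -- The slack `k` carries the induction: undoing the addition of a job raises it by one. Leaves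
  -- start at `suc C` because the value 0 is reserved for absent sets.
  step-sound : ∀ {C} js D t q {k} → k < val (step (suc C) js D t) q →
               ∃[ p ] ∃[ s ] (Move js D p q s × 0 < val t p × s + k ≤ C)
  step-sound {C} [] D (_ ∙ _) [] {k} lt = [] , 0 , [] , s≤s z≤n , s≤s⁻¹ (subst (k <_) (height-unary (suc C)) lt)
  step-sound {C} (j ∷ js) D (a ∙ b) (x ∷ q) {k} lt with closed j D in c
  step-sound {C} (j ∷ js) D (a ∙ b) (false ∷ q) lt | false =
    let p , s , mv , pos , le = step-sound js D a q lt in false ∷ p , s , skip mv , pos , le
  step-sound {C} (j ∷ js) D (a ∙ b) (true ∷ q) {k} lt | false = contradiction (subst (k <_) (val-nil q) lt) λ ()
  step-sound {C} (j ∷ js) D (a ∙ b) (false ∷ q) lt | true =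
    let p , s , mv , pos , le = step-sound js D a q lt in false ∷ p , s , skip mv , pos , le
  step-sound {C} (j ∷ js) D (a ∙ b) (true ∷ q) {k} lt | true
    -- The value is a maximum over two origins of `q`: `j` was in the old set, or it joins now.
    with k <? val (step (suc C) js (union (unit (toℕ j)) D) b) q
  ... | yes lt′ =
    let p , s , mv , pos , le = step-sound js (union (unit (toℕ j)) D) b q lt′ in true ∷ p , s , keep c mv , pos , le
  ... | no  ≮t =
    let p , s , mv , pos , le = step-sound js D a q (<-pred-suc (≰-⊔ (subst (k <_) (val-union i o q) lt)))
    in false ∷ p , suc s , add c mv , pos , ≤-trans (≤-reflexive (sym (+-suc s k))) le
    where
    i = step (suc C) js (union (unit (toℕ j)) D) b
    o = dec (length js) (step (suc C) js D a)
    ≰-⊔ : k < val i q ⊔ val o q → k < pred (val (step (suc C) js D a) q)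
    ≰-⊔ lt′ with ⊔-sel (val i q) (val o q)
    ... | inj₁ e = contradiction (subst (k <_) e lt′) ≮t
    ... | inj₂ e = subst (k <_) (trans e (val-dec (step (suc C) js D a) q)) lt′
    <-pred-suc : ∀ {k x} → k < pred x → suc k < x
    <-pred-suc {x = suc x} lt = s≤s lt

  -- The additive form survives truncation: `pred` lowers a value by at most one, so the sum never
  -- decreases when `s` grows by one, even after the budget is exhausted.
  step-complete : ∀ {C js D p q s} t → Move js D p q s → 0 < val t p → C < s + val (step (suc C) js D t) q
  step-complete {C} (_ ∙ _) [] _ = ≤-reflexive (sym (height-unary (suc C)))
  step-complete {C} {j ∷ js} {D} (a ∙ b) (skip mv) pos with closed j D
  ... | true  = step-complete a mv pos
  ... | false = step-complete a mv pos
  step-complete {C} {j ∷ js} {D} {true ∷ p} {true ∷ q} {s} (a ∙ b) (keep c mv) pos rewrite c =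
    ≤-trans (step-complete b mv pos) (+-monoʳ-≤ s (≤-trans (m≤m⊔n _ _) (≤-reflexive (sym (val-union _ _ q)))))
  step-complete {C} {j ∷ js} {D} {false ∷ p} {true ∷ q} {suc s} (a ∙ b) (add c mv) pos rewrite c = begin
    suc C                                       ≤⟨ step-complete a mv pos ⟩
    s + val o q                                 ≤⟨ +-monoʳ-≤ s (n≤suc-pred (val o q)) ⟩
    s + suc (pred (val o q))                    ≡⟨ +-suc s _ ⟩
    suc s + pred (val o q)                      ≡⟨ cong (suc s +_) (val-dec o q) ⟨
    suc s + val (dec (length js) o) q           ≤⟨ +-monoʳ-≤ (suc s) (m≤n⊔m (val i q) _) ⟩
    suc s + (val i q ⊔ val (dec (length js) o) q) ≡⟨ cong (suc s +_) (val-union i _ q) ⟨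
    suc s + val (union i (dec (length js) o)) q ∎
    where
    open ≤-Reasoning
    o = step (suc C) js D a
    i = step (suc C) js (union (unit (toℕ j)) D) b
    n≤suc-pred : ∀ x → x ≤ suc (pred x)
    n≤suc-pred zero    = z≤n
    n≤suc-pred (suc x) = ≤-refl

  move-⊆ : ∀ {js D p q s v} → Move js D p q s → At v js p → At v js q
  move-⊆ (skip mv)   (there a) = there (move-⊆ mv a)
  move-⊆ (keep _ mv) here      = here
  move-⊆ (keep _ mv) (there a) = there (move-⊆ mv a)
  move-⊆ (add _ mv)  (there a) = there (move-⊆ mv a)

  -- Kept and added jobs are both tested against old jobs only. At the root `D` is `nil`, so all
  -- successors of a job in the new set lie in the old one.
  move-closed : ∀ {js D p q s v w} → Move js D p q s → At v js q → v ≺ w → mem D (toℕ w) ≡ true ⊎ At w js p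
  move-closed (skip mv)   (there a) v≺w with move-closed mv a v≺w
  ... | inj₁ x = inj₁ x
  ... | inj₂ y = inj₂ (there y)
  move-closed (keep c mv) here      v≺w = inj₁ (closed-sound c v≺w)
  move-closed {j ∷ _} {D} {w = w} (keep c mv) (there a) v≺w with move-closed mv a v≺w
  ... | inj₂ y = inj₂ (there y)
  ... | inj₁ x with mem-union⁻ (unit (toℕ j)) D (toℕ w) x
  ...   | inj₂ z = inj₁ z
  ...   | inj₁ z with refl ← Fin.toℕ-injective (mem-unit (toℕ j) (toℕ w) z) = inj₂ here
  move-closed (add c mv)  here      v≺w = inj₁ (closed-sound c v≺w)
  move-closed (add c mv)  (there a) v≺w with move-closed mv a v≺w
  ... | inj₁ x = inj₁ x
  ... | inj₂ y = inj₂ (there y)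

  move-new : ∀ {js D p q s} → Move js D p q s →
             ∃[ xs ] (length xs ≡ s × (∀ {v} → At v js q → ¬ At v js p → v ∈ xs))
  move-new []          = [] , refl , λ ()
  move-new (skip mv)   = let xs , l , f = move-new mv in xs , l , λ { (there a) ∉p → f a (∉p ∘ there) }
  move-new (keep _ mv) = let xs , l , f = move-new mv in xs , l , λ
    { here      ∉p → contradiction here ∉p
    ; (there a) ∉p → f a (∉p ∘ there) }
  move-new {j ∷ _} (add _ mv) = let xs , l , f = move-new mv in j ∷ xs , cong suc l , λ
    { here      ∉p → here refl
    ; (there a) ∉p → there (f a (∉p ∘ there)) }

  -- From tries to layerings

  -- `m` is given in binary and may be exponential in the input size, whereas budgets are unary. No
  -- slot holds more than all jobs, so truncating loses no schedule and keeps the leaves linear in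
  -- n.
  C : ℕ
  C = length js ⊓ m

  trie : ℕ → Tree
  trie zero    = init (length js)
  trie (suc t) = step (suc C) js nil (trie t)

  -- Layers are time slots counted from the end of the schedule.
  record Layering (T : ℕ) : Set where
    field
      layer      : Fin n → ℕ
      layer<     : ∀ v → layer v < T
      decreasing : ∀ {v w} → v ≺ w → layer w < layer v
      width      : ∀ t → t < T → ∣ level layer t ∣ ≤ m

  -- Jobs outside `q` get the default layer `t`, the next slot to be filled. A job added there keeps
  -- its value, and only the jobs still left over move on to `suc t`.
  record Partial (t : ℕ) (q : Vec Bool (length js)) : Set where
    field
      layer      : Fin n → ℕ
      layer≤     : ∀ v → layer v ≤ t
      at⇒        : ∀ {v} → At v js q → layer v < t
      at⇐        : ∀ {v} → layer v < t → At v js q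
      decreasing : ∀ {v w} → At v js q → v ≺ w → layer w < layer v
      width      : ∀ i → i < t → ∣ level layer i ∣ ≤ C

  trie-sound : ∀ t q → 0 < val (trie t) q → Partial t q
  trie-sound zero    q pos = record
    { layer      = λ _ → 0
    ; layer≤     = λ _ → z≤n
    ; at⇒        = λ a → contradiction a (init-sound js q pos)
    ; at⇐        = λ ()
    ; decreasing = λ a → contradiction a (init-sound js q pos)
    ; width      = λ _ ()
    }
  trie-sound (suc t) q pos with p , s , mv , pos′ , s≤C ← step-sound js nil (trie t) q pos = record
    { layer      = layer′
    ; layer≤     = layer′≤
    ; at⇒        = λ a → s≤s (subst (_≤ t) (sym (old a)) (P.layer≤ _))
    ; at⇐        = at⇐′
    ; decreasing = decreasing′
    ; width      = width′
    }
    where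
    module P = Partial (trie-sound t p pos′)

    layer′ : Fin n → ℕ
    layer′ v with at? v js q
    ... | yes _ = P.layer v
    ... | no  _ = suc t

    old : ∀ {v} → At v js q → layer′ v ≡ P.layer v
    old {v} a with at? v js q
    ... | yes _ = refl
    ... | no ¬a = contradiction a ¬a

    layer′≤ : ∀ v → layer′ v ≤ suc t
    layer′≤ v with at? v js q
    ... | yes _ = m≤n⇒m≤1+n (P.layer≤ v)
    ... | no  _ = ≤-refl

    at⇐′ : ∀ {v} → layer′ v < suc t → At v js q
    at⇐′ {v} lt with at? v js q
    ... | yes a = a
    ... | no  _ = contradiction lt (n≮n _)

    at-successor : ∀ {v w} → At v js q → v ≺ w → At w js p
    at-successor a v≺w with inj₂ b ← move-closed mv a v≺w = b

    decreasing′ : ∀ {v w} → At v js q → v ≺ w → layer′ w < layer′ v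
    decreasing′ {v} {w} a v≺w = subst₂ _<_ (sym (old (move-⊆ mv b))) (sym (old a)) lt
      where
      b = at-successor a v≺w
      lt : P.layer w < P.layer v
      lt with at? v js p
      ... | yes a′ = P.decreasing a′ v≺w
      -- `v` joins in this slot and has the default layer `t`, whereas `w` was placed before.
      ... | no ¬a′ = <-≤-trans (P.at⇒ b) (≮⇒≥ (¬a′ ∘ P.at⇐))

    width′ : ∀ i → i < suc t → ∣ level layer′ i ∣ ≤ C
    width′ i i<1+t with m≤n⇒m<n∨m≡n (s≤s⁻¹ i<1+t)
    ... | inj₁ i<t = ≤-trans (Subset.p⊆q⇒∣p∣≤∣q∣ {p = level layer′ i} {level P.layer i} λ v∈ →
      ∈-level⁺ P.layer i (trans (sym (old (placed v∈))) (∈-level⁻ layer′ i v∈))) (P.width i i<t)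
      where
      placed : ∀ {v} → v Subset.∈ level layer′ i → At v js q
      placed {v} v∈ = at⇐′ (subst (_< suc t) (sym (∈-level⁻ layer′ i v∈)) i<1+t)
    ... | inj₂ refl with xs , refl , new ← move-new mv = ≤-trans
      (∣p∣≤length (level layer′ t) xs λ v∈ → let a = at⇐′ (subst (_< suc t) (sym (∈-level⁻ layer′ t v∈)) ≤-refl) in
        new a λ b → <⇒≢ (P.at⇒ b) (trans (sym (old a)) (∈-level⁻ layer′ t v∈)))
      (m+n≤o⇒m≤o (length xs) s≤C)

  ∈-js : ∀ v → v ∈ js
  ∈-js v = ∈-resp-↭ (↭-sym (sort-↭ (allFin n))) (∈-allFin v)

  unique-js : Unique js
  unique-js = Permutation.Unique-resp-↭ (setoid (Fin n)) (↭⇒↭ₛ (↭-sym (sort-↭ (allFin n)))) (Unique.allFin⁺ n)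

  Sorted : List (Fin n) → Set
  Sorted = AllPairs (λ a b → ¬ (a ≺ b))

  -- Stopping at the first `y` with `y ≺ x` is sound although the order is partial: `x ≺ z` for a
  -- later `z` would give `y ≺ z` by transitivity, which sortedness of the tail excludes.
  insert-sorted : ∀ x {ys} → Sorted ys → Sorted (insert x ys)
  insert-sorted x {[]}     _         = [] ∷ []
  insert-sorted x {y ∷ ys} (y⊀ ∷ s) with y ≺? x
  ... | yes y≺x = ((λ x≺y → ≺.irrefl refl (≺.trans x≺y y≺x)) ∷ All.map (λ y⊀z x≺z → y⊀z (≺.trans y≺x x≺z)) y⊀) ∷ y⊀ ∷ s
  ... | no  y⊀x = All-resp-↭ (↭-sym (insert-↭ x ys)) (y⊀x ∷ y⊀) ∷ insert-sorted x s

  sort-sorted : ∀ xs → Sorted (sort xs)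
  sort-sorted []       = []
  sort-sorted (x ∷ xs) = insert-sorted x (sort-sorted xs)

  layering : ∀ T → full (length js) (trie T) ≢ nil → Layering T
  layering T nonnil = record
    { layer      = P.layer
    ; layer<     = λ v → P.at⇒ (at-true (∈-js v))
    ; decreasing = λ {v} → P.decreasing (at-true (∈-js v))
    ; width      = λ t t<T → ≤-trans (P.width t t<T) (m⊓n≤n (length js) m)
    }
    where
    0<height : ∀ {t} → t ≢ nil → 0 < height t
    0<height {nil}   ≢nil = contradiction refl ≢nil
    0<height {_ ∙ _} _    = s≤s z≤n
    module P = Partial (trie-sound T (Vec.replicate (length js) true)
                         (subst (0 <_) (val-full (length js) (trie T)) (0<height nonnil)))

  -- From layerings to tries

  module _ {T} (L : Layering T) where
    open Layering L

    below : ℕ → Fin n → Bool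
    below t v = does (layer v <? t)

    private
      ∈-done : ∀ {j js D w} → All (λ k → ¬ (j ≺ k)) js → j ≺ w →
               mem D (toℕ w) ≡ true ⊎ w ∈ j ∷ js → mem D (toℕ w) ≡ true
      ∈-done j⊀ j≺w (inj₁ w∈D)         = w∈D
      ∈-done j⊀ j≺w (inj₂ (here refl)) = contradiction j≺w (≺.irrefl refl)
      ∈-done j⊀ j≺w (inj₂ (there w∈))  = contradiction j≺w (All.lookup j⊀ w∈)

      ∈-tail : ∀ {t j js D w} → ¬ (layer j < t) → layer w < t →
               mem D (toℕ w) ≡ true ⊎ w ∈ j ∷ js → mem D (toℕ w) ≡ true ⊎ w ∈ js
      ∈-tail ≮t lt (inj₁ w∈D)         = inj₁ w∈D
      ∈-tail ≮t lt (inj₂ (here refl)) = contradiction lt ≮t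
      ∈-tail ≮t lt (inj₂ (there w∈))  = inj₂ w∈

    -- The hypothesis says that the first `t` layers are in `D` or still ahead. A successor of a
    -- kept or added `j` lies in these layers, and by sortedness it is not ahead, so it is in `D`
    -- and `j` is closed.
    move-below : ∀ t js D → Sorted js → (∀ w → layer w < t → mem D (toℕ w) ≡ true ⊎ w ∈ js) →
                 Move js D (path (below t) js) (path (below (suc t)) js) (length (filter (λ j → layer j ℕ.≟ t) js))
    move-below t []       D _          _ = []
    move-below t (j ∷ js) D (j⊀ ∷ srt) f with <-cmp (layer j) t
    ... | tri< lt ≢ _ rewrite dec-true (layer j <? t) lt | dec-true (layer j <? suc t) (m<n⇒m<1+n lt)
                            | filter-reject (λ j → layer j ℕ.≟ t) {j} {js} ≢ =
      keep (closed-complete λ w j≺w → ∈-done {D = D} j⊀ j≺w (f w (<-trans (decreasing j≺w) lt)))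
           (move-below t js _ srt g)
      where
      g : ∀ w → layer w < t → mem (union (unit (toℕ j)) D) (toℕ w) ≡ true ⊎ w ∈ js
      g w lt with f w lt
      ... | inj₁ x           = inj₁ (mem-unionʳ (unit (toℕ j)) D (toℕ w) x)
      ... | inj₂ (here refl) = inj₁ (mem-unionˡ (unit (toℕ j)) D (toℕ w) (mem-unit-refl (toℕ w)))
      ... | inj₂ (there w∈)  = inj₂ w∈
    ... | tri≈ ≮t eq _ rewrite dec-false (layer j <? t) ≮t | dec-true (layer j <? suc t) (s≤s (≤-reflexive eq))
                            | filter-accept (λ j → layer j ℕ.≟ t) {j} {js} eq =
      add (closed-complete λ w j≺w → ∈-done {D = D} j⊀ j≺w (f w (subst (layer w <_) eq (decreasing j≺w))))
          (move-below t js D srt λ w lt → ∈-tail {D = D} ≮t lt (f w lt))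
    ... | tri> ≮t ≢ gt rewrite dec-false (layer j <? t) ≮t | dec-false (layer j <? suc t) (≤⇒≯ gt)
                            | filter-reject (λ j → layer j ℕ.≟ t) {j} {js} ≢ =
      skip (move-below t js D srt λ w lt → ∈-tail {D = D} ≮t lt (f w lt))

    trie-complete : ∀ t → t ≤ T → 0 < val (trie t) (path (below t) js)
    trie-complete zero    _   = init-complete js λ v → dec-false (layer v <? 0) λ ()
    trie-complete (suc t) t<T = +-cancelˡ-< s 0 _ (begin-strict
      s + 0                                              ≡⟨ +-identityʳ s ⟩
      -- The two bounds match the two parts of `C`: the slot is a part of `js`, and its width is at
      -- most `m`.
      s                                                  ≤⟨ ⊓-glb (length-filter here? js) (≤-trans s≤∣level∣ (width t t<T)) ⟩
      C                                                  <⟨ step-complete (trie t) mv (trie-complete t (<⇒≤ t<T)) ⟩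
      s + val (trie (suc t)) (path (below (suc t)) js)   ∎)
      where
      open ≤-Reasoning
      here? = λ j → layer j ℕ.≟ t
      s = length (filter here? js)
      mv = move-below t js nil (sort-sorted (allFin n)) λ w _ → inj₂ (∈-js w)
      s≤∣level∣ : s ≤ ∣ level layer t ∣
      s≤∣level∣ = length≤∣p∣ (level layer t) (Unique.filter⁺ here? unique-js)
                    λ x∈ → ∈-level⁺ layer t (proj₂ (∈-filter⁻ here? {xs = js} x∈))

    full-complete : full (length js) (trie T) ≢ nil
    full-complete eq = contradiction
      (subst (0 <_) (trans (cong (val (trie T)) (path-true js λ v → dec-true (layer v <? T) (layer< v)))
                           (trans (sym (val-full (length js) (trie T))) (cong height eq)))
             (trie-complete T ≤-refl))
      λ ()

  -- The serial layering

  position : List (Fin n) → Fin n → ℕ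
  position []       v = 0
  position (j ∷ js) v with j ≟ v
  ... | yes _ = 0
  ... | no  _ = suc (position js v)

  position< : ∀ {js v} → v ∈ js → position js v < length js
  position< {j ∷ js} {v} v∈ with j ≟ v
  ... | yes _ = s≤s z≤n
  position< {j ∷ js} {v} (here refl) | no j≢v = contradiction refl j≢v
  position< {j ∷ js} {v} (there v∈)  | no _   = s≤s (position< v∈)

  position-decreasing : ∀ {js v w} → Sorted js → v ∈ js → w ∈ js → v ≺ w → position js w < position js v
  position-decreasing {j ∷ js} {v} {w} (j⊀ ∷ s) v∈ w∈ v≺w with j ≟ v | j ≟ w
  position-decreasing (j⊀ ∷ s) v∈ w∈          v≺w | yes refl | yes refl = contradiction v≺w (≺.irrefl refl)
  position-decreasing (j⊀ ∷ s) v∈ (here refl) v≺w | yes refl | no j≢w   = contradiction refl j≢w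
  position-decreasing (j⊀ ∷ s) v∈ (there w∈)  v≺w | yes refl | no _     = contradiction v≺w (All.lookup j⊀ w∈)
  position-decreasing (j⊀ ∷ s) v∈ w∈          v≺w | no _     | yes _    = s≤s z≤n
  position-decreasing (j⊀ ∷ s) (here refl) w∈ v≺w | no j≢v   | no _     = contradiction refl j≢v
  position-decreasing (j⊀ ∷ s) (there v∈) (here refl) v≺w | no _ | no j≢w = contradiction refl j≢w
  position-decreasing (j⊀ ∷ s) (there v∈) (there w∈)  v≺w | no _ | no _   = s≤s (position-decreasing s v∈ w∈ v≺w)

  position-injective : ∀ {js v w} → v ∈ js → w ∈ js → position js v ≡ position js w → v ≡ w
  position-injective {j ∷ js} {v} {w} v∈ w∈ eq with j ≟ v | j ≟ w
  position-injective v∈ w∈ eq | yes refl | yes refl = refl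
  position-injective (here refl) w∈ eq | no j≢v | no _ = contradiction refl j≢v
  position-injective (there v∈) (here refl) eq | no _ | no j≢w = contradiction refl j≢w
  position-injective (there v∈) (there w∈) eq | no _ | no _ = position-injective v∈ w∈ (suc-injective eq)

  subsingleton-∣p∣≤1 : ∀ (p : Subset n) → (∀ {v w} → v Subset.∈ p → w Subset.∈ p → v ≡ w) → ∣ p ∣ ≤ 1
  subsingleton-∣p∣≤1 p unique with members p in e
  ... | []     = ≤-trans (≤-reflexive (trans (sym (length-members p)) (cong length e))) z≤n
  ... | x ∷ xs = ∣p∣≤length p (x ∷ []) λ v∈ → here (unique v∈ (∈-members⁻ p (subst (x ∈_) (sym e) (here refl))))

  -- One job per layer, in sorted order; it guarantees that the loop stops within n passes.
  serial : Layering n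
  serial = record
    { layer      = position js
    ; layer<     = λ v → subst (position js v <_) length-js (position< (∈-js v))
    ; decreasing = λ {v} {w} → position-decreasing (sort-sorted (allFin n)) (∈-js v) (∈-js w)
    ; width      = λ t _ → ≤-trans
        (subsingleton-∣p∣≤1 (level (position js) t) λ {v} {w} v∈ w∈ →
          position-injective (∈-js v) (∈-js w) (trans (∈-level⁻ (position js) t v∈) (sym (∈-level⁻ (position js) t w∈))))
        (>-nonZero⁻¹ m)
    }

  -- Schedules and layerings

  opposite-< : ∀ {T} {i j : Fin T} → i Fin.< j → opposite j Fin.< opposite i
  opposite-< {T} {i} {j} i<j = subst₂ _<_ (sym (Fin.opposite-prop j)) (sym (Fin.opposite-prop i))
    (∸-monoʳ-< (s≤s i<j) (Fin.toℕ<n j))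

  opposite-≤ : ∀ {T} {i j : Fin T} → i Fin.≤ j → opposite j Fin.≤ opposite i
  opposite-≤ {T} {i} {j} i≤j = subst₂ _≤_ (sym (Fin.opposite-prop j)) (sym (Fin.opposite-prop i))
    (∸-monoʳ-≤ T (s≤s i≤j))

  schedule : ∀ {T} → Layering T → Schedule I T
  schedule {T} L = record
    { slot       = λ i → level layer (toℕ (opposite i))
    ; partition  = λ v → opposite (fromℕ< (layer< v))
        , ∈-level⁺ layer _ (sym (trans (cong toℕ (Fin.opposite-involutive (fromℕ< (layer< v)))) (Fin.toℕ-fromℕ< (layer< v))))
        , λ {i} v∈ → trans
            (cong opposite (Fin.toℕ-injective (trans (Fin.toℕ-fromℕ< (layer< v)) (∈-level⁻ layer (toℕ (opposite i)) v∈))))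
            (Fin.opposite-involutive i)
    ; capacity   = λ i → width (toℕ (opposite i)) (Fin.toℕ<n (opposite i))
    ; precedence = λ {v} {w} {i} {j} v≺w v∈ w∈ → ≰⇒> λ j≤i → <⇒≱ (decreasing v≺w)
        (subst₂ _≤_ (sym (∈-level⁻ layer _ v∈)) (sym (∈-level⁻ layer _ w∈)) (opposite-≤ {i = j} {i} j≤i))
    }
    where open Layering L

  fromSchedule : ∀ {T} → Schedule I T → Layering T
  fromSchedule {T} S = record
    { layer      = λ v → toℕ (opposite (time v))
    ; layer<     = λ v → Fin.toℕ<n (opposite (time v))
    ; decreasing = λ {v} {w} v≺w → opposite-< {i = time v} {time w} (precedence v≺w (time-∈ v) (time-∈ w))
    ; width      = λ t t<T → ≤-trans
        (Subset.p⊆q⇒∣p∣≤∣q∣ {p = level (λ v → toℕ (opposite (time v))) t} λ {v} v∈ → subst (λ i → v Subset.∈ slot i)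
          (trans (sym (Fin.opposite-involutive (time v)))
                 (cong opposite (Fin.toℕ-injective (trans (∈-level⁻ (λ v → toℕ (opposite (time v))) t v∈) (sym (Fin.toℕ-fromℕ< t<T))))))
          (time-∈ v))
        (capacity (opposite (fromℕ< t<T)))
    }
    where
    open Schedule S
    time : Fin n → Fin T
    time v = proj₁ (partition v)
    time-∈ : ∀ v → v Subset.∈ slot (time v)
    time-∈ v = proj₁ (proj₂ (partition v))

  -- Upsets and antichains

  _∋_ : Tree → Fin n → Set
  D ∋ v = mem D (toℕ v) ≡ true

  _∋?_ : ∀ D v → Dec (D ∋ v)
  D ∋? v = mem D (toℕ v) ≟ᵇ true

  IsUpset : Tree → Set
  IsUpset D = ∀ {v w} → v ≺ w → D ∋ v → D ∋ w

  upsets : List (Fin n) → Tree → List Tree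
  upsets []       D = D ∷ []
  upsets (j ∷ js) D = upsets js D ++ (if closed j D then upsets js (union (unit (toℕ j)) D) else [])

  length-upsets : ∀ js D → length (upsets js D) ≡ leaves js D
  length-upsets []       D = refl
  length-upsets (j ∷ js) D rewrite length-++ (upsets js D) {if closed j D then upsets js (union (unit (toℕ j)) D) else []}
    with closed j D
  ... | true  = cong₂ _+_ (length-upsets js D) (length-upsets js (union (unit (toℕ j)) D))
  ... | false = cong (_+ 0) (length-upsets js D)

  ∋-unit-union : ∀ j D → union (unit (toℕ j)) D ∋ j
  ∋-unit-union j D = mem-unionˡ (unit (toℕ j)) D (toℕ j) (mem-unit-refl (toℕ j))

  ∋-unit-union⁻ : ∀ {j v} D → union (unit (toℕ j)) D ∋ v → j ≡ v ⊎ D ∋ v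
  ∋-unit-union⁻ {j} {v} D p with mem-union⁻ (unit (toℕ j)) D (toℕ v) p
  ... | inj₁ q = inj₁ (Fin.toℕ-injective (mem-unit (toℕ j) (toℕ v) q))
  ... | inj₂ q = inj₂ q

  ∈-upsets⁻ : ∀ {j js D E} → E ∈ upsets (j ∷ js) D →
              E ∈ upsets js D ⊎ (closed j D ≡ true × E ∈ upsets js (union (unit (toℕ j)) D))
  ∈-upsets⁻ {j} {js} {D} E∈ with ∈-++⁻ (upsets js D) E∈
  ... | inj₁ x = inj₁ x
  ... | inj₂ y with true ← closed j D = inj₂ (refl , y)

  upset-add : ∀ {j D} → closed j D ≡ true → IsUpset D → IsUpset (union (unit (toℕ j)) D)
  upset-add {j} {D} c up {v} {w} v≺w p with ∋-unit-union⁻ {j} {v} D p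
  ... | inj₁ refl = mem-unionʳ (unit (toℕ j)) D (toℕ w) (closed-sound c v≺w)
  ... | inj₂ q    = mem-unionʳ (unit (toℕ j)) D (toℕ w) (up v≺w q)

  upsets-sound : ∀ js {D E} → IsUpset D → E ∈ upsets js D → IsUpset E
  upsets-sound []       up (here refl) = up
  upsets-sound (j ∷ js) {D} up E∈ with ∈-upsets⁻ {j} {js} {D} E∈
  ... | inj₁ x       = upsets-sound js up x
  ... | inj₂ (c , y) = upsets-sound js (upset-add c up) y

  upsets-⊇ : ∀ js {D E v} → E ∈ upsets js D → D ∋ v → E ∋ v
  upsets-⊇ []       (here refl) p = p
  upsets-⊇ (j ∷ js) {D} {v = v} E∈ p with ∈-upsets⁻ {j} {js} {D} E∈
  ... | inj₁ x       = upsets-⊇ js x p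
  ... | inj₂ (_ , y) = upsets-⊇ js y (mem-unionʳ (unit (toℕ j)) D (toℕ v) p)

  upsets-⊆ : ∀ js {D E v} → E ∈ upsets js D → v ∉ js → E ∋ v → D ∋ v
  upsets-⊆ []       (here refl) _ p = p
  upsets-⊆ (j ∷ js) {D} {v = v} E∈ v∉ p with ∈-upsets⁻ {j} {js} {D} E∈
  ... | inj₁ x       = upsets-⊆ js x (v∉ ∘ there) p
  ... | inj₂ (_ , y) with ∋-unit-union⁻ {j} {v} D (upsets-⊆ js y (v∉ ∘ there) p)
  ...   | inj₁ refl = contradiction (here refl) v∉
  ...   | inj₂ q    = q

  Minimal : Tree → Fin n → Set
  Minimal E v = E ∋ v × ∀ w → w ≺ v → ¬ E ∋ w

  minimal? : ∀ E → Decidable (Minimal E)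
  minimal? E v = E ∋? v ×-dec Fin.all? λ w → w ≺? v →-dec ¬? (E ∋? w)

  minimals : Tree → Subset n
  minimals E = ⟪ minimal? E ⟫

  minimals-antichain : ∀ E → IsAntichain I (minimals E)
  minimals-antichain E v v∈ w w∈ _ =
    let Ev , v-min = ∈-⟪⟫⁻ (minimal? E) v∈
        Ew , w-min = ∈-⟪⟫⁻ (minimal? E) w∈
    in (λ v≺w → w-min v v≺w Ev) , (λ w≺v → v-min w w≺v Ew)

  -- Descend from `v` inside `E` to a minimal element, which belongs to `F`, and climb back in the
  -- upset `F`. Hence two upsets with the same minimal elements coincide.
  minimals-generate : ∀ {E F v} → IsUpset F → minimals E ≡ minimals F → E ∋ v → F ∋ v
  minimals-generate {E} {F} {v} up eq = go (spo-wellFounded ≺.isStrictPartialOrder v)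
    where
    go : ∀ {v} → Acc _≺_ v → E ∋ v → F ∋ v
    go {v} (acc rs) Ev with Fin.any? (λ w → w ≺? v ×-dec E ∋? w)
    ... | yes (w , w≺v , Ew) = up w≺v (go (rs w≺v) Ew)
    ... | no  ∄w = proj₁ (∈-⟪⟫⁻ (minimal? F) (subst (v Subset.∈_) eq
                       (∈-⟪⟫⁺ (minimal? E) (Ev , λ w w≺v Ew → ∄w (w , w≺v , Ew)))))

  -- The sets in the second half contain `j`; those in the first do not, as `j` is neither in `D`
  -- nor in the rest of the list. Distinctness is claimed for the minimal elements, because
  -- different trees may encode the same set.
  upsets-distinct : ∀ js {D} → IsUpset D → Unique js → All (λ j → ¬ D ∋ j) js →
                    AllPairs (λ E F → minimals E ≢ minimals F) (upsets js D)
  upsets-distinct []           up _        _          = [] ∷ []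
  upsets-distinct (j ∷ js) {D} up (j∉ ∷ u) (Dj ∷ Djs) = AllPairs.++⁺
    (upsets-distinct js up u Djs) second
    (All.tabulate λ {E} E∈ → All.tabulate λ {F} F∈ eq → Dj (upsets-⊆ js {v = j} E∈ (λ j∈ → All.lookup j∉ j∈ refl)
      (minimals-generate {F} {E} {j} (upsets-sound js up E∈) (sym eq) (second-∋ F∈))))
    where
    second : AllPairs (λ E F → minimals E ≢ minimals F) (if closed j D then upsets js (union (unit (toℕ j)) D) else [])
    second with closed j D in c
    ... | false = []
    ... | true  = upsets-distinct js (upset-add c up) u
      (All.tabulate λ {k} k∈ p → [ All.lookup j∉ k∈ , All.lookup Djs k∈ ] (∋-unit-union⁻ {j} {k} D p))
    second-∋ : ∀ {F} → F ∈ (if closed j D then upsets js (union (unit (toℕ j)) D) else []) → F ∋ j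
    second-∋ F∈ with true ← closed j D = upsets-⊇ js F∈ (∋-unit-union j D)

  leaves≤#AC : leaves js nil ≤ #AC I
  leaves≤#AC = begin
    leaves js nil                        ≡⟨ length-upsets js nil ⟨
    length (upsets js nil)               ≡⟨ length-map minimals (upsets js nil) ⟨
    length (map minimals (upsets js nil)) ≤⟨ unique⇒length≤
      (AllPairs.map⁺ (upsets-distinct js (λ _ ()) unique-js (All.tabulate λ _ ())))
      (λ A∈ → let E , _ , A≡ = ∈-map⁻ minimals A∈ in
        ∈-filter⁺ (isAntichain? I) (∈-allSubsets _) (subst (IsAntichain I) (sym A≡) (minimals-antichain E))) ⟩
    #AC I                                ∎
    where open ≤-Reasoning

  -- The main loop and the total cost

  Full : ℕ → Set
  Full t = full (length js) (trie t) ≢ nil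

  stepCost : ℕ
  stepCost = suc n * ((1 + R + R + (2 * n + size (unary (suc C)))) * leaves js nil)

  trie-app : ∀ t → App STEP (jobs js ∷ nil ∷ trie t ∷ unary (suc C) ∷ []) (trie (suc t)) stepCost
  trie-app t = subst (λ l → App STEP (jobs js ∷ nil ∷ trie t ∷ unary (suc C) ∷ []) (trie (suc t))
                                (suc l * ((1 + R + R + (2 * n + size (unary (suc C)))) * leaves js nil)))
    length-js (step-app js nil (trie t) (≤-reflexive (cong (λ l → 2 * l + size (unary (suc C))) length-js)))

  full-trie-app : ∀ t → App FULL (jobs js ∷ trie t ∷ []) (full (length js) (trie t)) (suc n)
  full-trie-app t = subst₂ (λ l k → App FULL (jobs js ∷ trie t ∷ []) (full l (trie t)) (suc k))
    (length-map job js) (trans (length-map job js) length-js) (full-app (map job js) (trie t))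

  -- `r` counts the passes left until a trie known to be full, which excludes running out with
  -- `r = 0`. Minimality holds because each `t` is tested in turn. A round pays for `FULL`, `STEP`,
  -- `INC` and the call of `LOOP` itself.
  loop-app : ∀ r t → r + t ≤ n → Full (r + t) →
             ∃[ T ] (Full T × (∀ t′ → t ≤ t′ → Full t′ → T ≤ t′) ×
                     App LOOP (jobs js ∷ trie t ∷ encodeℕ t ∷ unary (suc C) ∷ []) (encodeℕ T)
                         (suc r * (suc n + stepCost + suc n + 1)))
  loop-app r t r+t≤n Fr with full (length js) (trie t) in e | full-trie-app t
  ... | _ ∙ _ | d = t , (λ eq → contradiction (trans (sym e) eq) λ ()) , (λ _ t≤t′ _ → t≤t′) ,
    app (case-cons′ (call′ (var′ ∷′ var′ ∷′ []′) d) var′) (begin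
      suc (suc n + 0)                            ≡⟨ cong suc (+-identityʳ (suc n)) ⟩
      suc (suc n)                                ≡⟨ +-comm 1 (suc n) ⟩
      suc n + 1                                  ≤⟨ +-monoˡ-≤ 1 (≤-trans (m≤m+n (suc n) stepCost) (m≤m+n _ (suc n))) ⟩
      suc n + stepCost + suc n + 1               ≤⟨ m≤m+n _ _ ⟩
      suc r * (suc n + stepCost + suc n + 1)     ∎)
    where open ≤-Reasoning
  loop-app zero    t r+t≤n Fr | nil | d = contradiction e Fr
  loop-app (suc r) t r+t≤n Fr | nil | d
    with T , FT , least , a ← loop-app r (suc t) (subst (_≤ n) (sym (+-suc r t)) r+t≤n) (subst Full (sym (+-suc r t)) Fr) =
    T , FT , least′ ,
    app (case-nil′ (call′ (var′ ∷′ var′ ∷′ []′) d)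
          (call′ (var′ ∷′ call′ (var′ ∷′ nil′ ∷′ var′ ∷′ var′ ∷′ []′) (trie-app t) ∷′ call′ (var′ ∷′ []′) (inc-app t) ∷′ var′ ∷′ []′) a))
    (begin
      suc (suc n + (stepCost + (suc t + 0) + rest))  ≡⟨ lemma (suc n) stepCost (suc t) rest ⟩
      suc n + stepCost + suc t + 1 + rest            ≤⟨ +-monoˡ-≤ rest (+-monoˡ-≤ 1 (+-monoʳ-≤ (suc n + stepCost) (s≤s t≤n))) ⟩
      suc n + stepCost + suc n + 1 + rest            ∎)
    where
    open ≤-Reasoning
    rest = suc r * (suc n + stepCost + suc n + 1)
    t≤n : t ≤ n
    t≤n = ≤-trans (m≤n+m t (suc r)) r+t≤n
    least′ : ∀ t′ → t ≤ t′ → Full t′ → T ≤ t′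
    least′ t′ t≤t′ F′ with m≤n⇒m<n∨m≡n t≤t′
    ... | inj₁ t<t′ = least t′ t<t′ F′
    ... | inj₂ refl = contradiction e F′
    lemma : ∀ a b c d → suc (a + (b + (c + 0) + d)) ≡ a + b + c + 1 + d
    lemma = solve-∀

  -- The calls of `MK`, `INIT`, `CAP` and `LOOP`, grouped as the run of the main expression adds
  -- them.
  calls : ℕ
  calls = suc (n * (2 + n * suc R)) +
          (suc n + (suc (n * suc (size (encodeℕ m) + n)) + 0) + suc n * (suc n + stepCost + suc n + 1))

  solve-app : ∃[ T ] (IsMinMakespan I T × Run (encodeInstance I ∷ []) (Program.main solver) (encodeℕ T) calls)
  solve-app with T , FT , least , a ← loop-app n 0 (≤-reflexive (+-identityʳ n))
                                        (subst Full (sym (+-identityʳ n)) (full-complete serial)) =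
    T , (schedule (layering T FT) , λ T′ S → least T′ z≤n (full-complete (fromSchedule S))) ,
    case-cons′ var′ (bind′
      (call′ (var′ ∷′ cons′ (cons′ nil′ nil′) nil′ ∷′ []′) (mk-app {k = 0} id ≤-refl λ _ → refl))
      (call′ (var′ ∷′ call′ (var′ ∷′ []′) initial ∷′ nil′ ∷′
              cons′ nil′ (call′ (var′ ∷′ var′ ∷′ nil′ ∷′ []′) capacity) ∷′ []′) a))
    where
    initial : App INIT (jobs js ∷ []) (init (length js)) (suc n)
    initial = subst₂ (λ l k → App INIT (jobs js ∷ []) (init l) (suc k))
      (length-map job js) (trans (length-map job js) length-js) (init-app (map job js))
    capacity : App CAP (jobs js ∷ encodeℕ m ∷ nil ∷ []) (unary C) (suc (n * suc (size (encodeℕ m) + n)))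
    capacity = subst₂ (λ l k → App CAP (jobs js ∷ encodeℕ m ∷ nil ∷ []) (unary (l ⊓ m)) (suc (k * suc (size (encodeℕ m) + n))))
      (length-map job js) (trans (length-map job js) length-js)
      (cap-app (map job js) 0 m (+-monoʳ-≤ (size (encodeℕ m)) (≤-reflexive (trans (length-map job js) length-js))))

  stepCost≤ : stepCost ≤ suc N * ((4 + 18 * N) * leaves js nil)
  stepCost≤ = *-mono-≤ (s≤s n≤N) (*-monoˡ-≤ (leaves js nil) (begin
    1 + R + R + (2 * n + size (unary (suc C)))  ≡⟨ cong (λ x → 1 + R + R + (2 * n + x)) (size-unary (suc C)) ⟩
    1 + R + R + (2 * n + suc (2 * suc C))       ≤⟨ +-monoʳ-≤ (1 + R + R) (+-mono-≤ (*-monoʳ-≤ 2 n≤N) (s≤s (*-monoʳ-≤ 2 (s≤s C≤N)))) ⟩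
    1 + R + R + (2 * N + suc (2 * suc N))       ≡⟨ lemma N ⟩
    4 + 18 * N                                  ∎))
    where
    open ≤-Reasoning
    C≤N : C ≤ N
    C≤N = ≤-trans (m⊓n≤m (length js) m) (≤-trans (≤-reflexive length-js) n≤N)
    lemma : ∀ N → 1 + 7 * N + 7 * N + (2 * N + suc (2 * suc N)) ≡ 4 + 18 * N
    lemma = solve-∀

  -- Every monomial of the expanded bound is at most `N ^ 3 * leaves js nil`, as both factors are
  -- positive; 115 is the sum of the coefficients.
  calls≤ : calls ≤ 115 * (N ^ 3 * leaves js nil)
  calls≤ = begin
    calls
      ≤⟨ +-mono-≤ (s≤s (*-mono-≤ n≤N (+-monoʳ-≤ 2 (*-monoˡ-≤ (suc R) n≤N))))
           (+-mono-≤ (+-mono-≤ (s≤s n≤N) (+-monoˡ-≤ 0 (s≤s (*-mono-≤ n≤N (s≤s (+-mono-≤ size-m n≤N))))))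
                     (*-mono-≤ (s≤s n≤N) (+-monoˡ-≤ 1 (+-mono-≤ (+-mono-≤ (s≤s n≤N) stepCost≤) (s≤s n≤N))))) ⟩
    suc (N * (2 + N * suc (7 * N))) +
      (suc N + (suc (N * suc (N + N)) + 0) + suc N * (suc N + suc N * ((4 + 18 * N) * L) + suc N + 1))
      ≡⟨ expand N L ⟩
    6 * (1 * 1) + 9 * (N * 1) + 5 * (N ^ 2 * 1) + 7 * (N ^ 3 * 1) + 4 * (1 * L) + 26 * (N * L) + 40 * (N ^ 2 * L) + 18 * (N ^ 3 * L)
      ≤⟨ +-mono-≤ (+-mono-≤ (+-mono-≤ (+-mono-≤ (+-mono-≤ (+-mono-≤ (+-mono-≤
           (*-monoʳ-≤ 6 (*-mono-≤ 1≤N³ 1≤L)) (*-monoʳ-≤ 9 (*-mono-≤ N≤N³ 1≤L))) (*-monoʳ-≤ 5 (*-mono-≤ N²≤N³ 1≤L)))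
           (*-monoʳ-≤ 7 (*-monoʳ-≤ (N ^ 3) 1≤L))) (*-monoʳ-≤ 4 (*-monoˡ-≤ L 1≤N³))) (*-monoʳ-≤ 26 (*-monoˡ-≤ L N≤N³)))
           (*-monoʳ-≤ 40 (*-monoˡ-≤ L N²≤N³))) ≤-refl ⟩
    6 * u + 9 * u + 5 * u + 7 * u + 4 * u + 26 * u + 40 * u + 18 * u
      ≡⟨ collect u ⟩
    115 * u ∎
    where
    open ≤-Reasoning
    L = leaves js nil
    u = N ^ 3 * L
    1≤L : 1 ≤ L
    1≤L = leaves-pos js nil
    N²≤N³ : N ^ 2 ≤ N ^ 3
    N²≤N³ = m≤n*m (N ^ 2) N
    N≤N³ : N ≤ N ^ 3
    N≤N³ = ≤-trans (≤-reflexive (sym (^-identityʳ N))) (≤-trans (m≤n*m (N ^ 1) N) N²≤N³)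
    1≤N³ : 1 ≤ N ^ 3
    1≤N³ = ≤-trans 1≤N N≤N³
    expand : ∀ N L → suc (N * (2 + N * suc (7 * N))) +
      (suc N + (suc (N * suc (N + N)) + 0) + suc N * (suc N + suc N * ((4 + 18 * N) * L) + suc N + 1)) ≡
      6 * (1 * 1) + 9 * (N * 1) + 5 * ((N * (N * 1)) * 1) + 7 * ((N * (N * (N * 1))) * 1) + 4 * (1 * L) + 26 * (N * L) + 40 * ((N * (N * 1)) * L) + 18 * ((N * (N * (N * 1))) * L)
    expand = solve-∀
    collect : ∀ u → 6 * u + 9 * u + 5 * u + 7 * u + 4 * u + 26 * u + 40 * u + 18 * u ≡ 115 * u
    collect = solve-∀

  -- Multiplying by `2 ^ m` expresses the term 2^(n-m) without subtraction, also for m > n. The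
  -- constant is 50 for the main expression plus 50 · 115 for the calls.
  bound≤ : ∀ {c} → c ≤ weight (Program.main solver) + 50 * calls →
           c * 2 ^ m ≤ 5800 * N ^ 3 * (2 ^ n + #AC I * 2 ^ m)
  bound≤ {c} c≤ = begin
    c * 2 ^ m                                          ≤⟨ *-monoˡ-≤ (2 ^ m) c≤ ⟩
    (weight (Program.main solver) + 50 * calls) * 2 ^ m
      ≤⟨ *-monoˡ-≤ (2 ^ m) (+-mono-≤ (≤-trans (from-yes (weight (Program.main solver) ≤? 50)) (*-monoʳ-≤ 50 1≤u))
                                     (*-monoʳ-≤ 50 calls≤)) ⟩
    (50 * u + 50 * (115 * u)) * 2 ^ m                  ≡⟨ rearrange (N ^ 3) (leaves js nil) (2 ^ m) ⟩
    5800 * N ^ 3 * (leaves js nil * 2 ^ m)             ≤⟨ *-monoʳ-≤ (5800 * N ^ 3) (*-monoˡ-≤ (2 ^ m) leaves≤#AC) ⟩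
    5800 * N ^ 3 * (#AC I * 2 ^ m)                     ≤⟨ *-monoʳ-≤ (5800 * N ^ 3) (m≤n+m (#AC I * 2 ^ m) (2 ^ n)) ⟩
    5800 * N ^ 3 * (2 ^ n + #AC I * 2 ^ m)             ∎
    where
    open ≤-Reasoning
    u = N ^ 3 * leaves js nil
    1≤u : 1 ≤ u
    1≤u = *-mono-≤ {1} {N ^ 3} {1} (m^n>0 N 3) (leaves-pos js nil)
    rearrange : ∀ p l e → (50 * (p * l) + 50 * (115 * (p * l))) * e ≡ 5800 * p * (l * e)
    rearrange = solve-∀

theorem5p5 : ∃[ P ] ∃[ a ] ∃[ d ] ((I : Instance) →
    let open Instance I
        x = encodeInstance I
    in ∃[ T ] ∃[ c ]
         (IsMinMakespan I T
         × (P on x outputs encodeℕ T after c steps)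
         × (c * 2 ^ m ≤ a * size x ^ d * (2 ^ n + #AC I * 2 ^ m))))
theorem5p5 = solver , 5800 , 3 , λ I →
  let T , minimum , run eval bound = Solving.solve-app I
  in T , _ , minimum , eval , Solving.bound≤ I bound
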